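{- Let $1\le i<j$ be fixed integers and fix $0<c<1$. Let $m=cn$ and let $\pi$ be chosen uniformly at random from $\mathrm{PF}(m,n)$. Then, as $n\to\infty$, $$\operatorname{Var}(k_i)\sim\frac{ic}{(1-c)^3},\qquad \operatorname{Cov}(k_i,k_j)\sim\frac{ic}{(1-c)^3},$$ where $k_i=k_i(\pi)$ is the $i$th unattempted spot of $\pi$.
   Context: Write $[n]=\{1,\dots,n\}$. For integers $0\le m\le n$, $\mathrm{PF}(m,n)$ denotes the set of parking functions with $m$ cars and $n$ spots: sequences $(\pi_1,\dots,\pi_m)\in[n]^m$ such that, when cars $1,\dots,m$ enter in order a one-way street with spots $1,\dots,n$ and car $i$ parks in spot $\pi_i$ if it is free and otherwise in the first free spot after $\pi_i$, all cars park. Equivalently, the non-decreasing rearrangement $(\lambda_1,\dots,\lambda_m)$ satisfies $\lambda_i\le n-m+i$ for all $i$. For $\pi\in\mathrm{PF}(m,n)$ exactly $n-m$ spots are never attempted by any car (they are the spots left empty after all cars have parked); they are listed as $k_1(\pi)<k_2(\pi)<\cdots<k_{n-m}(\pi)$. Here $\sim$ means that the ratio of the two sides tends to $1$; the limit $n\to\infty$ is along integers $n$ with $cn$ an integer (and $n$ large enough that $n-m\ge j$). -}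

module Defs where

open import Data.Nat as ℕ using (ℕ; zero; suc; _∸_)
open import Data.Integer using (+_)
open import Data.Rational
  using (ℚ; 0ℚ; 1ℚ; _/_; _+_; _-_; _*_; -_; _÷_; _<_; ∣_∣; NonZero; Positive; positive)
open import Data.Rational.Properties
  using (+-monoˡ-<; +-inverseʳ; pos*pos⇒pos; 1/pos⇒pos; pos⇒nonZero; normalize-pos)
open import Data.Fin using (Fin; toℕ; _≤_)
open import Data.Fin.Properties using (_≤?_; any?)
open import Data.Fin.Subset using (Subset; ⊥; ⁅_⁆; _∪_)
open import Data.Fin.Subset.Properties using (_∈?_)
open import Data.Vec using (Vec; []; _∷_; lookup)
open import Data.List using (List; []; _∷_; [_]; allFin; cartesianProductWith; drop; filter; foldr; head; length; map)
open import Data.Maybe as Maybe using (Maybe; just; Is-just; fromMaybe; _>>=_)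
open import Data.Maybe.Relation.Unary.Any using (Any; dec)
open import Data.Product using (∃; _×_)
open import Data.Unit using (tt)
open import Relation.Binary.PropositionalEquality using (_≡_; subst)
open import Relation.Nullary using (yes; ¬?)
open import Relation.Nullary.Decidable using (_×-dec_)
open import Relation.Unary using (Decidable)

private
  variable
    m n : ℕ

-- A preference sequence is a Vec (Fin n) m, listing the preferred spots of
-- cars 1, …, m; spot number s ∈ {1, …, n} is the element of Fin n with
-- toℕ value s − 1.

firstFree : Subset n → Fin n → Maybe (Fin n)
firstFree occupied p =
  head (filter (λ s → (p ≤? s) ×-dec ¬? (s ∈? occupied)) (allFin _))

-- The spots in which the successive cars park, or nothing if some car fails
-- to park.
parkFrom : Subset n → Vec (Fin n) m → Maybe (Vec (Fin n) m)
parkFrom occupied []      = just []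
parkFrom occupied (p ∷ π) =
  firstFree occupied p >>= λ s →
  Maybe.map (s ∷_) (parkFrom (occupied ∪ ⁅ s ⁆) π)

park : Vec (Fin n) m → Maybe (Vec (Fin n) m)
park = parkFrom ⊥

IsParking : Vec (Fin n) m → Set
IsParking π = Is-just (park π)

isParking? : Decidable (IsParking {n} {m})
isParking? π = dec (λ _ → yes tt) (park π)

preferences : ∀ m n → List (Vec (Fin n) m)
preferences zero    n = [ [] ]
preferences (suc m) n = cartesianProductWith _∷_ (allFin n) (preferences m n)

PF : ∀ m n → List (Vec (Fin n) m)
PF m n = filter isParking? (preferences m n)

-- A car that prefers p and parks in s attempts exactly the spots p, …, s.
Attempted : Vec (Fin n) m → Fin n → Set
Attempted π t =
  Any (λ s → ∃ λ car → lookup π car ≤ t × t ≤ lookup s car) (park π)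

attempted? : (π : Vec (Fin n) m) → Decidable (Attempted π)
attempted? π t =
  dec (λ s → any? λ car → (lookup π car ≤? t) ×-dec (t ≤? lookup s car)) (park π)

-- In increasing order, since allFin is increasing.
unattempted : Vec (Fin n) m → List (Fin n)
unattempted π = filter (λ t → ¬? (attempted? π t)) (allFin _)

-- The spot number k_i(π), for 1 ≤ i ≤ n − m and π a parking function; the
-- default 0 (not a spot number) is returned only when i exceeds the number
-- of unattempted spots.
k : ℕ → Vec (Fin n) m → ℕ
k i π = fromMaybe 0 (head (drop (i ∸ 1) (map (λ t → suc (toℕ t)) (unattempted π))))

fromℕ : ℕ → ℚ
fromℕ a = + a / 1

sum : List ℚ → ℚ
sum = foldr _+_ 0ℚ

-- PF m n is nonempty whenever m ≤ n, so the first clause is irrelevant there.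
mean : List ℚ → ℚ
mean []          = 0ℚ
mean xs@(_ ∷ ys) = sum xs * (+ 1 / suc (length ys))

-- Expectation under the uniform distribution on PF m n.
𝔼 : (Vec (Fin n) m → ℚ) → ℚ
𝔼 {n} {m} X = mean (map X (PF m n))

Cov : (X Y : Vec (Fin n) m → ℚ) → ℚ
Cov X Y = 𝔼 (λ π → (X π - 𝔼 X) * (Y π - 𝔼 Y))

Var : (X : Vec (Fin n) m → ℚ) → ℚ
Var X = Cov X X

kℚ : ∀ m n → ℕ → Vec (Fin n) m → ℚ
kℚ m n i π = fromℕ (k i π)

-- Ratio asymptotics f(m,n) ∼ L as n → ∞ along the pairs (m,n) with m = cn and
-- n − m ≥ j.  Taking c rational loses nothing: if cn is an integer for some
-- n ≥ 1 then c is rational.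
Asymptotic : (c : ℚ) (j : ℕ) (f : ℕ → ℕ → ℚ) (L : ℚ) .{{_ : NonZero L}} → Set
Asymptotic c j f L =
  ∀ ε → 0ℚ < ε → ∃ λ N → ∀ m n → N ℕ.≤ n →
  fromℕ m ≡ c * fromℕ n → j ℕ.≤ n ∸ m →
  ∣ f m n ÷ L - 1ℚ ∣ < ε

cube : ℚ → ℚ
cube x = x * x * x

cube-pos : ∀ {x} → 0ℚ < x → Positive (cube x)
cube-pos {x} 0<x = pos*pos⇒pos (x * x) x
  where
  instance
    x-pos : Positive x
    x-pos = positive 0<x
    x²-pos : Positive (x * x)
    x²-pos = pos*pos⇒pos x x

0<1-c : ∀ {c} → c < 1ℚ → 0ℚ < 1ℚ - c
0<1-c {c} c<1 = subst (_< 1ℚ - c) (+-inverseʳ c) (+-monoˡ-< (- c) c<1)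

cube-nonZero : ∀ {c} → c < 1ℚ → NonZero (cube (1ℚ - c))
cube-nonZero {c} c<1 = pos⇒nonZero (cube (1ℚ - c)) {{cube-pos (0<1-c c<1)}}

ic/[1-c]³ : (i : ℕ) (c : ℚ) → c < 1ℚ → ℚ
ic/[1-c]³ i c c<1 = (fromℕ i * c ÷ cube (1ℚ - c)) {{cube-nonZero c<1}}

ic/[1-c]³-nonZero : ∀ {i c} → 1 ℕ.≤ i → 0ℚ < c → (c<1 : c < 1ℚ) →
                    NonZero (ic/[1-c]³ i c c<1)
ic/[1-c]³-nonZero {suc i} {c} _ 0<c c<1 = pos⇒nonZero (ic/[1-c]³ (suc i) c c<1)
  where
  instance
    cube⁺ : Positive (cube (1ℚ - c))
    cube⁺ = cube-pos (0<1-c c<1)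
    c⁺ : Positive c
    c⁺ = positive 0<c
    i⁺ : Positive (fromℕ (suc i))
    i⁺ = normalize-pos (suc i) 1
    ic⁺ : Positive (fromℕ (suc i) * c)
    ic⁺ = pos*pos⇒pos (fromℕ (suc i)) c
    ratio⁺ : Positive (ic/[1-c]³ (suc i) c c<1)
    ratio⁺ = pos*pos⇒pos (fromℕ (suc i) * c) _ {{1/pos⇒pos (cube (1ℚ - c))}}

{-# OPTIONS --safe #-}
-- Record a preference sequence by its content (c_1, …, c_n), where c_t cars prefer
-- spot t. Whatever the order of the cars, k_j is the time at which the walk with
-- start j and steps c_t − 1 first reaches 0, and all cars park iff the walk with
-- start y = n − m + 1 stays positive. Conditioning on the number of cars that
-- prefer the first spot gives, by induction on n and with N = n + 1,
--   |PF(m, n)| = y Nᵐ⁻¹,  Σ k_j = j Nᵐ,  Σ k_i k_j = i (j Q + Z)  for i ≤ j,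
-- where Q = Σₖ m(m−1)⋯(m−k+1) Nᵐ⁻ᵏ and Z is the same sum weighted by k. Since
-- y Q + Z = Nᵐ⁺¹, the covariance is exactly i N Z (y − j) / (y² Nᵐ), and
-- Z = (m Nᵐ⁺¹ / y²) (1 − O(1/n)) follows from elementary recurrences.
module Submission where

open import Defs
open import Data.Bool using (true; false)
open import Data.Fin as Fin using (Fin; zero; suc; toℕ)
open import Data.Fin.Subset using (Subset; inside; outside; ⊥; ⁅_⁆; _∪_; _∈_; _∉_)
open import Data.Fin.Subset.Properties using (_∈?_; drop-there; ∉⊥; ∪-identityʳ; x∈⁅x⁆; x∈⁅y⁆⇒x≡y; x∈p∪q⁺; x∈p∪q⁻)
open import Data.List as List using (List; []; _∷_; _++_; allFin; cartesianProductWith; drop; filter; head; length; tabulate)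
open import Data.List.Properties using (drop-map; filter-≐; head-map; length-map; map-cong; map-tabulate; map-∘)
open import Data.Maybe as Maybe using (Maybe; just; nothing; fromMaybe)
open import Data.Maybe.Relation.Unary.Any using (Any; just)
open import Data.Nat as ℕ using (ℕ; zero; suc)
import Data.Nat.Coprimality as Coprimality
import Data.Nat.Properties as ℕ
open import Data.Nat.Tactic.RingSolver using (solve-∀)
open import Data.Product using (∃; _×_; _,_; proj₁; proj₂)
import Data.Rational.Unnormalised as ℚᵘ
import Data.Rational.Unnormalised.Properties as ℚᵘ
open import Data.Sum using (_⊎_; inj₁; inj₂)
open import Data.Unit using (tt)
open import Data.Vec as Vec using (Vec; []; _∷_; lookup; replicate)
open import Function using (_∘_; flip; id)
open import Level using (0ℓ)
open import Relation.Binary.PropositionalEquality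
open import Relation.Nullary using (¬_; ¬?; yes; no; does; contradiction)
open import Relation.Nullary.Decidable using (_×-dec_)
open import Relation.Unary using (Decidable; Pred)

-- Removing the first spot, preferred by `d` cars, sends `(n, m, y, i, j)` to `(n - 1, m - d, y - 1
-- + d, i - 1 + d, j - 1 + d)`. The starts cannot stay fixed, so every sum is evaluated for all
-- starts below `y`; the relation `y + m = n + 1` survives because both sides drop by one. As the
-- starts grow with `d`, terms such as `(i + d) R q (j + d) e` must be summed against binomial
-- coefficients, and the identities for `split` provide this. In the covariance `Q` cancels, since
-- `y (j Q + Z) - j (y Q + Z) = (y - j) Z`. Thus `j` survives only in the factor `(y - j) / y`,
-- which tends to 1, and this is why variance and covariance share the limit of `i m N² / y³`.
-- Counting and estimates stay in ℕ: negative terms are moved to the other side and denominators are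
-- multiplied out. Rationals enter only with the mean and the final ratio.

-- Binomial sums and the moments of hitting times over contents.

module ContentSums where

  open import Data.Nat
  open import Data.Nat.Properties

  -- Σ_d C(m, d) f(d, m − d), the binomial coefficients arising from Pascal's rule.
  split : ℕ → (ℕ → ℕ → ℕ) → ℕ
  split zero    f = f 0 0
  split (suc m) f = split m (λ d e → f (suc d) e) + split m (λ d e → f d (suc e))

  interchange : ∀ a b c d → (a + b) + (c + d) ≡ (a + c) + (b + d)
  interchange = solve-∀

  split-cong : ∀ m {f g} → (∀ d e → d + e ≡ m → f d e ≡ g d e) → split m f ≡ split m g
  split-cong zero    f≗g = f≗g 0 0 refl
  split-cong (suc m) f≗g = cong₂ _+_
    (split-cong m λ d e eq → f≗g (suc d) e (cong suc eq))
    (split-cong m λ d e eq → f≗g d (suc e) (trans (+-suc d e) (cong suc eq)))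

  split-cong′ : ∀ m {f g} → (∀ d e → f d e ≡ g d e) → split m f ≡ split m g
  split-cong′ m f≗g = split-cong m λ d e _ → f≗g d e

  split-+ : ∀ m f g → split m (λ d e → f d e + g d e) ≡ split m f + split m g
  split-+ zero    f g = refl
  split-+ (suc m) f g = trans
    (cong₂ _+_ (split-+ m (λ d e → f (suc d) e) (λ d e → g (suc d) e))
               (split-+ m (λ d e → f d (suc e)) (λ d e → g d (suc e))))
    (interchange (split m (λ d e → f (suc d) e)) _ _ _)

  split-* : ∀ m k f → split m (λ d e → k * f d e) ≡ k * split m f
  split-* zero    k f = refl
  split-* (suc m) k f = trans
    (cong₂ _+_ (split-* m k (λ d e → f (suc d) e)) (split-* m k (λ d e → f d (suc e))))
    (sym (*-distribˡ-+ k (split m (λ d e → f (suc d) e)) _))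

  split-0 : ∀ m → split m (λ _ _ → 0) ≡ 0
  split-0 m = split-* m 0 (λ _ _ → 0)

  split-flip : ∀ m f → split m f ≡ split m (flip f)
  split-flip zero    f = refl
  split-flip (suc m) f = trans
    (cong₂ _+_ (split-flip m (λ d e → f (suc d) e)) (split-flip m (λ d e → f d (suc e))))
    (+-comm (split m (flip λ d e → f (suc d) e)) _)

  split-^ : ∀ m q → split m (λ _ e → q ^ e) ≡ suc q ^ m
  split-^ zero    q = refl
  split-^ (suc m) q = cong₂ _+_ (split-^ m q)
    (trans (split-* m q (λ _ e → q ^ e)) (cong (q *_) (split-^ m q)))

  -- m f(m − 1), without the predecessor.
  down : (ℕ → ℕ) → ℕ → ℕ
  down f zero    = 0
  down f (suc m) = suc m * f m

  -- Marking one of the `e` cars of the second group amounts to marking one of the `m` cars and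
  -- splitting the others: `C(m, d) (m - d) = m C(m - 1, d)`.
  split-downʳ : ∀ m f → split m (λ d e → down (f d) e) ≡ down (λ m → split m f) m
  split-downʳ zero    f = refl
  split-downʳ (suc m) f = begin
    split m (λ d e → down (f (suc d)) e) + split m (λ d e → f d e + e * f d e)
      ≡⟨ cong₂ _+_ (split-downʳ m (λ d → f (suc d)))
           (trans (split-+ m f (λ d e → e * f d e)) (cong (split m f +_)
             (trans (split-cong′ m e*f) (split-downʳ m (λ d e → f d (suc e)))))) ⟩
    down (λ m → split m λ d e → f (suc d) e) m
      + (split m f + down (λ m → split m λ d e → f d (suc e)) m)
      ≡⟨ merge m ⟩
    suc m * split m f ∎
    where
    open ≡-Reasoning
    e*f : ∀ d e → e * f d e ≡ down (λ e → f d (suc e)) e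
    e*f d zero    = refl
    e*f d (suc e) = refl
    ring : ∀ k a b c → k * a + (c + k * b) ≡ c + k * (a + b)
    ring = solve-∀
    merge : ∀ m → down (λ m → split m λ d e → f (suc d) e) m
      + (split m f + down (λ m → split m λ d e → f d (suc e)) m) ≡ suc m * split m f
    merge zero    = refl
    merge (suc m) = ring (suc m) (split m λ d e → f (suc d) e) (split m λ d e → f d (suc e)) (split (suc m) f)

  split-downˡ : ∀ m f → split m (λ d e → down (λ d → f d e) d) ≡ down (λ m → split m f) m
  split-downˡ m f = begin
    split m (λ d e → down (λ d → f d e) d)   ≡⟨ split-flip m _ ⟩
    split m (λ d e → down (flip f d) e)      ≡⟨ split-downʳ m (flip f) ⟩
    down (λ m → split m (flip f)) m          ≡⟨ down-cong m (λ m → sym (split-flip m f)) ⟩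
    down (λ m → split m f) m                 ∎
    where
    open ≡-Reasoning
    down-cong : ∀ {f g : ℕ → ℕ} m → (∀ m → f m ≡ g m) → down f m ≡ down g m
    down-cong zero    f≗g = refl
    down-cong (suc m) f≗g = cong (suc m *_) (f≗g m)

  split-d*^ : ∀ m q → split m (λ d e → d * q ^ e) ≡ down (suc q ^_) m
  split-d*^ m q = trans (split-cong′ m d*) (trans (split-downˡ m (λ _ e → q ^ e)) (eq m))
    where
    d* : ∀ d e → d * q ^ e ≡ down (λ _ → q ^ e) d
    d* zero    e = refl
    d* (suc d) e = refl
    eq : ∀ m → down (λ m → split m (λ _ e → q ^ e)) m ≡ down (suc q ^_) m
    eq zero    = refl
    eq (suc m) = cong (suc m *_) (split-^ m q)

  split-linear*^ : ∀ m k q → split m (λ d e → (k + d) * q ^ e) ≡ k * suc q ^ m + down (suc q ^_) m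
  split-linear*^ m k q = begin
    split m (λ d e → (k + d) * q ^ e)
      ≡⟨ split-cong′ m (λ d e → *-distribʳ-+ (q ^ e) k d) ⟩
    split m (λ d e → k * q ^ e + d * q ^ e)
      ≡⟨ split-+ m (λ d e → k * q ^ e) (λ d e → d * q ^ e) ⟩
    split m (λ d e → k * q ^ e) + split m (λ d e → d * q ^ e)
      ≡⟨ cong₂ _+_ (trans (split-* m k (λ _ e → q ^ e)) (cong (k *_) (split-^ m q))) (split-d*^ m q) ⟩
    k * suc q ^ m + down (suc q ^_) m ∎
    where open ≡-Reasoning

  -- In the `d²` term one factor `d` goes through `split-downˡ`, which leaves `(1 + d) q^e` on one
  -- car fewer, a linear moment. With `suc m` cars every outer `down` unfolds.
  split-quadratic*^ : ∀ m i j q → split (suc m) (λ d e → (i + d) * ((j + d) * q ^ e)) ≡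
    i * (j * suc q ^ suc m) + (i + j) * (suc m * suc q ^ m) + suc m * (suc q ^ m + down (suc q ^_) m)
  split-quadratic*^ m i j q = begin
    split (suc m) (λ d e → (i + d) * ((j + d) * q ^ e))
      ≡⟨ split-cong′ (suc m) (λ d e → expand i j d (q ^ e)) ⟩
    split (suc m) (λ d e → i * ((j + d) * q ^ e) + (j * (d * q ^ e) + d * (d * q ^ e)))
      ≡⟨ trans (split-+ (suc m) (λ d e → i * ((j + d) * q ^ e)) (λ d e → j * (d * q ^ e) + d * (d * q ^ e)))
           (cong₂ _+_ (trans (split-* (suc m) i (λ d e → (j + d) * q ^ e)) (cong (i *_) (split-linear*^ (suc m) j q)))
             (trans (split-+ (suc m) (λ d e → j * (d * q ^ e)) (λ d e → d * (d * q ^ e)))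
               (cong₂ _+_ (trans (split-* (suc m) j (λ d e → d * q ^ e)) (cong (j *_) (split-d*^ (suc m) q)))
                 (trans (split-cong′ (suc m) d*)
                   (trans (split-downˡ (suc m) (λ d e → suc d * q ^ e))
                     (cong (suc m *_) (split-linear*^ m 1 q))))))) ⟩
    i * (j * suc q ^ suc m + suc m * suc q ^ m)
      + (j * (suc m * suc q ^ m) + suc m * (1 * suc q ^ m + down (suc q ^_) m))
      ≡⟨ collect i j (suc m) (suc q ^ suc m) (suc q ^ m) (down (suc q ^_) m) ⟩
    i * (j * suc q ^ suc m) + (i + j) * (suc m * suc q ^ m) + suc m * (suc q ^ m + down (suc q ^_) m) ∎
    where
    open ≡-Reasoning
    expand : ∀ i j d p → (i + d) * ((j + d) * p) ≡ i * ((j + d) * p) + (j * (d * p) + d * (d * p))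
    expand = solve-∀
    collect : ∀ i j m p′ p D → i * (j * p′ + m * p) + (j * (m * p) + m * (1 * p + D)) ≡
              i * (j * p′) + (i + j) * (m * p) + m * (p + D)
    collect = solve-∀
    d* : ∀ d e → d * (d * q ^ e) ≡ down (λ d → suc d * q ^ e) d
    d* zero    e = refl
    d* (suc d) e = refl

  -- Q, Z and Z₂ are Σₖ kᵃ m(m−1)⋯(m−k+1) Nᵐ⁻ᵏ for a = 0, 1, 2.
  Q Z Z₂ : ℕ → ℕ → ℕ
  Q N zero     = 1
  Q N (suc m)  = N ^ suc m + suc m * Q N m
  Z N zero     = 0
  Z N (suc m)  = suc m * (Z N m + Q N m)
  Z₂ N zero    = 0
  Z₂ N (suc m) = suc m * (Z₂ N m + 2 * Z N m + Q N m)

  R : ℕ → ℕ → ℕ → ℕ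
  R N j m = j * Q N m + Z N m

  -- `R N j m` is the sum over `k` of `(j + k) m(m-1)...(m-k+1) N^(m-k)`. Here the term `k = 0` is
  -- split off; the others share one factor, and shifting `k` raises `j`.
  R-suc : ∀ N j m → R N j (suc m) ≡ j * N ^ suc m + suc m * R N (suc j) m
  R-suc N j m = ring j (N ^ suc m) (suc m) (Q N m) (Z N m)
    where
    ring : ∀ j p m q z → j * (p + m * q) + m * (z + q) ≡ j * p + m * (q + j * q + z)
    ring = solve-∀

  -- By `R-suc`, `R q (j + d) e` is `(j + d) q^e` plus `e` times a value of `R` with `e - 1` cars;
  -- `split-downʳ` pulls this `e` out as `m`, leaving the same sum for `j + 1` and one car fewer.
  -- The added `down` and power terms are what `contentSum-hit-hit` leaves over when
  -- `(1 + a)(1 + b)` is expanded.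
  split-*R : ∀ m i j q → split m (λ d e → (i + d) * R q (j + d) e) + down (suc q ^_) m + suc (i + j) * suc q ^ m
                       ≡ suc i * R (suc q) (suc j) m
  split-*R zero i j q = ring i j
    where
    ring : ∀ i j → (i + 0) * ((j + 0) * 1 + 0) + 0 + suc (i + j) * 1 ≡ suc i * (suc j * 1 + 0)
    ring = solve-∀
  split-*R (suc m) i j q = begin
    split (suc m) (λ d e → (i + d) * R q (j + d) e) + down N^ (suc m) + suc (i + j) * N^ (suc m)
      ≡⟨ cong (λ s → s + down N^ (suc m) + suc (i + j) * N^ (suc m)) recurse ⟩
    i * (j * N^ (suc m)) + (i + j) * (suc m * N^ m) + suc m * (N^ m + down N^ m) + suc m * X
      + suc m * N^ m + suc (i + j) * N^ (suc m)
      ≡⟨ ring₁ i j (suc m) (N^ (suc m)) (N^ m) (down N^ m) X ⟩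
    suc i * (suc j * N^ (suc m)) + suc m * (X + down N^ m + suc (i + suc j) * N^ m)
      ≡⟨ cong (λ s → suc i * (suc j * N^ (suc m)) + suc m * s) (split-*R m i (suc j) q) ⟩
    suc i * (suc j * N^ (suc m)) + suc m * (suc i * R (suc q) (suc (suc j)) m)
      ≡⟨ ring₂ (suc i) (suc j * N^ (suc m)) (suc m) (R (suc q) (suc (suc j)) m) ⟩
    suc i * (suc j * N^ (suc m) + suc m * R (suc q) (suc (suc j)) m)
      ≡⟨ cong (suc i *_) (R-suc (suc q) (suc j) m) ⟨
    suc i * R (suc q) (suc j) (suc m) ∎
    where
    open ≡-Reasoning
    N^ : ℕ → ℕ
    N^ = suc q ^_
    X = split m (λ d e → (i + d) * R q (suc j + d) e)
    ring₁ : ∀ i j m p′ p D X →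
            i * (j * p′) + (i + j) * (m * p) + m * (p + D) + m * X + m * p + suc (i + j) * p′
          ≡ suc i * (suc j * p′) + m * (X + D + suc (i + suc j) * p)
    ring₁ = solve-∀
    ring₂ : ∀ i p m r → i * p + m * (i * r) ≡ i * (p + m * r)
    ring₂ = solve-∀
    term : ∀ d e → (i + d) * R q (j + d) e ≡
           (i + d) * ((j + d) * q ^ e) + down (λ e → (i + d) * R q (suc j + d) e) e
    term d zero    = ring i j d
      where
      ring : ∀ i j d → (i + d) * ((j + d) * 1 + 0) ≡ (i + d) * ((j + d) * 1) + 0
      ring = solve-∀
    term d (suc e) = trans (cong ((i + d) *_) (R-suc q (j + d) e))
                           (ring (i + d) ((j + d) * q ^ suc e) (suc e) (R q (suc j + d) e))
      where
      ring : ∀ i p m r → i * (p + m * r) ≡ i * p + m * (i * r)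
      ring = solve-∀
    recurse : split (suc m) (λ d e → (i + d) * R q (j + d) e) ≡
      i * (j * N^ (suc m)) + (i + j) * (suc m * N^ m) + suc m * (N^ m + down N^ m) + suc m * X
    recurse = begin
      split (suc m) (λ d e → (i + d) * R q (j + d) e)
        ≡⟨ split-cong′ (suc m) term ⟩
      split (suc m) (λ d e → (i + d) * ((j + d) * q ^ e) + down (λ e → (i + d) * R q (suc j + d) e) e)
        ≡⟨ split-+ (suc m) (λ d e → (i + d) * ((j + d) * q ^ e)) (λ d e → down (λ e → (i + d) * R q (suc j + d) e) e) ⟩
      split (suc m) (λ d e → (i + d) * ((j + d) * q ^ e))
        + split (suc m) (λ d e → down (λ e → (i + d) * R q (suc j + d) e) e)
        ≡⟨ cong₂ _+_ (split-quadratic*^ m i j q) (split-downʳ (suc m) (λ d e → (i + d) * R q (suc j + d) e)) ⟩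
      _ ∎

  -- The sum of g over the contents cs of all preference sequences of m cars on n
  -- spots; the first step decides which of the cars prefer the first spot.
  contentSum : ∀ n → ℕ → (Vec ℕ n → ℕ) → ℕ
  contentSum zero    zero    g = g []
  contentSum zero    (suc m) g = 0
  contentSum (suc n) m       g = split m λ d e → contentSum n e λ cs → g (d ∷ cs)

  contentSum-cong : ∀ n m {f g} → (∀ cs → f cs ≡ g cs) → contentSum n m f ≡ contentSum n m g
  contentSum-cong zero    zero    f≗g = f≗g []
  contentSum-cong zero    (suc m) f≗g = refl
  contentSum-cong (suc n) m       f≗g = split-cong′ m λ d e → contentSum-cong n e λ cs → f≗g (d ∷ cs)

  contentSum-+ : ∀ n m f g → contentSum n m (λ cs → f cs + g cs) ≡ contentSum n m f + contentSum n m g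
  contentSum-+ zero    zero    f g = refl
  contentSum-+ zero    (suc m) f g = refl
  contentSum-+ (suc n) m       f g = trans
    (split-cong′ m λ d e → contentSum-+ n e (λ cs → f (d ∷ cs)) (λ cs → g (d ∷ cs)))
    (split-+ m (λ d e → contentSum n e λ cs → f (d ∷ cs)) (λ d e → contentSum n e λ cs → g (d ∷ cs)))

  contentSum-0 : ∀ n m → contentSum n m (λ _ → 0) ≡ 0
  contentSum-0 zero    zero    = refl
  contentSum-0 zero    (suc m) = refl
  contentSum-0 (suc n) m       = trans (split-cong′ m λ _ e → contentSum-0 n e) (split-0 m)

  -- The time at which the walk with start j and steps c − 1 first reaches 0 (junk
  -- value n if it does not); on the content of a parking function it is k_j.
  hit : ∀ {n} → ℕ → Vec ℕ n → ℕ
  hit zero    cs       = 0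
  hit (suc j) []       = 0
  hit (suc j) (c ∷ cs) = suc (hit (j + c) cs)

  -- 1 or 0 according to whether the walk with start y stays positive and ends at 1.
  ok : ∀ {n} → ℕ → Vec ℕ n → ℕ
  ok zero          _        = 0
  ok (suc y)       (c ∷ cs) = ok (y + c) cs
  ok (suc zero)    []       = 1
  ok (suc (suc y)) []       = 0

  shift : ∀ y d e {m n} → suc y + m ≡ suc (suc n) → d + e ≡ m → (y + d) + e ≡ suc n
  shift y d e p refl = trans (+-assoc y d e) (suc-injective p)

  -- `split-^` and `split-downʳ` carry `(n + 1)^e` and its correction to the same expressions with
  -- base `n + 2`, so the closed form reproduces itself. A walk already at 0 contributes nothing,
  -- and there `m = N` makes `m N^(m-1)` equal to `N^m`.
  contentSum-ok : ∀ n m y → y + m ≡ suc n → contentSum n m (ok y) + down (suc n ^_) m ≡ suc n ^ m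
  contentSum-ok zero    zero          (suc zero) refl = refl
  contentSum-ok zero    (suc zero)    zero       refl = refl
  contentSum-ok zero    m (suc (suc y)) ()
  contentSum-ok zero    (suc m) (suc zero) ()
  contentSum-ok (suc n) m             zero       refl =
    cong (_+ down (suc (suc n) ^_) m) (trans (split-cong′ m λ _ e → contentSum-0 n e) (split-0 m))
  contentSum-ok (suc n) m             (suc y)    eq   = begin
    split m f + down (suc (suc n) ^_) m         ≡⟨ cong (split m f +_) D ⟨
    split m f + split m (λ _ e → down (suc n ^_) e) ≡⟨ split-+ m f (λ _ e → down (suc n ^_) e) ⟨
    split m (λ d e → f d e + down (suc n ^_) e)
      ≡⟨ split-cong m (λ d e d+e≡m → contentSum-ok n e (y + d) (shift y d e eq d+e≡m)) ⟩
    split m (λ _ e → suc n ^ e)                 ≡⟨ split-^ m (suc n) ⟩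
    suc (suc n) ^ m                             ∎
    where
    open ≡-Reasoning
    f : ℕ → ℕ → ℕ
    f d e = contentSum n e (ok (y + d))
    D : split m (λ _ e → down (suc n ^_) e) ≡ down (suc (suc n) ^_) m
    D = trans (split-downʳ m (λ _ e → suc n ^ e)) (eq′ m)
      where
      eq′ : ∀ m → down (λ m → split m (λ _ e → suc n ^ e)) m ≡ down (suc (suc n) ^_) m
      eq′ zero    = refl
      eq′ (suc m) = cong (suc m *_) (split-^ m (suc n))

  -- If the walk from `y` ends at 1, the one from `j < y` ends at or below 0; its steps are at least
  -- -1, so it has hit 0 and the junk value of `hit` never counts. Unfolding `hit` once adds the
  -- number of good contents, which with the correction `D` makes the missing `N^m`.
  contentSum-hit : ∀ n m y j → j < y → y + m ≡ suc n →
    contentSum n m (λ cs → ok y cs * hit j cs) ≡ j * suc n ^ m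
  contentSum-hit zero m y zero j<y eq = trans (contentSum-cong 0 m λ cs → *-zeroʳ (ok y cs)) (contentSum-0 0 m)
  contentSum-hit zero m (suc zero) (suc j) (s≤s ()) eq
  contentSum-hit zero m (suc (suc y)) (suc j) j<y ()
  contentSum-hit (suc n) m y zero j<y eq =
    trans (contentSum-cong (suc n) m λ cs → *-zeroʳ (ok y cs)) (contentSum-0 (suc n) m)
  contentSum-hit (suc n) m (suc y) (suc j) (s≤s j<y) eq = begin
    split m (λ d e → contentSum n e λ cs → ok (y + d) cs * suc (hit (j + d) cs))
      ≡⟨ split-cong m inner ⟩
    split m (λ d e → f d e + (j + d) * suc n ^ e)
      ≡⟨ split-+ m f _ ⟩
    split m f + split m (λ d e → (j + d) * suc n ^ e)
      ≡⟨ cong (split m f +_) (split-linear*^ m j (suc n)) ⟩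
    split m f + (j * P + D)
      ≡⟨ ring (split m f) (j * P) D ⟩
    (split m f + D) + j * P
      ≡⟨ cong (_+ j * P) (contentSum-ok (suc n) m (suc y) eq) ⟩
    P + j * P ∎
    where
    open ≡-Reasoning
    f : ℕ → ℕ → ℕ
    f d e = contentSum n e (ok (y + d))
    P = suc (suc n) ^ m
    D = down (suc (suc n) ^_) m
    ring : ∀ a b c → a + (b + c) ≡ (a + c) + b
    ring = solve-∀
    inner : ∀ d e → d + e ≡ m → contentSum n e (λ cs → ok (y + d) cs * suc (hit (j + d) cs)) ≡
                                f d e + (j + d) * suc n ^ e
    inner d e d+e≡m = trans (contentSum-cong n e λ cs → *-suc (ok (y + d) cs) _)
      (trans (contentSum-+ n e (ok (y + d)) (λ cs → ok (y + d) cs * hit (j + d) cs))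
        (cong (f d e +_) (contentSum-hit n e (y + d) (j + d) (+-monoˡ-< d j<y) (shift y d e eq d+e≡m))))

  -- The recursion ends when the lower walk stands at 0, where both sides vanish; hence `i` is a
  -- factor while `j` sits inside `R`. Before that, expanding the two successors gives the count,
  -- two single sums and the product sum, which `split-*R` assembles.
  contentSum-hit-hit : ∀ n m y i j → i ≤ j → j < y → y + m ≡ suc n →
    contentSum n m (λ cs → ok y cs * (hit i cs * hit j cs)) ≡ i * R (suc n) j m
  contentSum-hit-hit n m y zero j i≤j j<y eq =
    trans (contentSum-cong n m λ cs → *-zeroʳ (ok y cs)) (contentSum-0 n m)
  contentSum-hit-hit zero m (suc zero) (suc i) (suc j) i≤j (s≤s ()) eq
  contentSum-hit-hit zero m (suc (suc y)) (suc i) (suc j) i≤j j<y ()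
  contentSum-hit-hit (suc n) m (suc y) (suc i) (suc j) (s≤s i≤j) (s≤s j<y) eq = begin
    split m (λ d e → contentSum n e λ cs → ok (y + d) cs * (suc (hit (i + d) cs) * suc (hit (j + d) cs)))
      ≡⟨ split-cong m inner ⟩
    split m (λ d e → f d e + (i + d) * suc n ^ e + ((j + d) * suc n ^ e + (i + d) * R (suc n) (j + d) e))
      ≡⟨ trans (split-+ m (λ d e → f d e + (i + d) * suc n ^ e) _)
           (cong₂ _+_ (split-+ m f (λ d e → (i + d) * suc n ^ e))
                      (split-+ m (λ d e → (j + d) * suc n ^ e) (λ d e → (i + d) * R (suc n) (j + d) e))) ⟩
    split m f + split m (λ d e → (i + d) * suc n ^ e) + (split m (λ d e → (j + d) * suc n ^ e) + X)
      ≡⟨ cong₂ (λ a b → split m f + a + (b + X)) (split-linear*^ m i (suc n)) (split-linear*^ m j (suc n)) ⟩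
    split m f + (i * P + D) + (j * P + D + X)
      ≡⟨ ring₁ (split m f) (i * P) (j * P) D X ⟩
    (split m f + D) + (i * P + j * P) + (X + D)
      ≡⟨ cong (λ s → s + (i * P + j * P) + (X + D)) (contentSum-ok (suc n) m (suc y) eq) ⟩
    P + (i * P + j * P) + (X + D)
      ≡⟨ ring₂ P i j X D ⟩
    X + D + suc (i + j) * P
      ≡⟨ split-*R m i j (suc n) ⟩
    suc i * R (suc (suc n)) (suc j) m ∎
    where
    open ≡-Reasoning
    f : ℕ → ℕ → ℕ
    f d e = contentSum n e (ok (y + d))
    P = suc (suc n) ^ m
    D = down (suc (suc n) ^_) m
    X = split m (λ d e → (i + d) * R (suc n) (j + d) e)
    ring₁ : ∀ s a b D X → s + (a + D) + (b + D + X) ≡ (s + D) + (a + b) + (X + D)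
    ring₁ = solve-∀
    ring₂ : ∀ P i j X D → P + (i * P + j * P) + (X + D) ≡ X + D + suc (i + j) * P
    ring₂ = solve-∀
    expand : ∀ o a b → o * (suc a * suc b) ≡ o + o * a + (o * b + o * (a * b))
    expand = solve-∀
    inner : ∀ d e → d + e ≡ m →
            contentSum n e (λ cs → ok (y + d) cs * (suc (hit (i + d) cs) * suc (hit (j + d) cs))) ≡
            f d e + (i + d) * suc n ^ e + ((j + d) * suc n ^ e + (i + d) * R (suc n) (j + d) e)
    inner d e d+e≡m = trans (contentSum-cong n e λ cs → expand (ok (y + d) cs) (hit (i + d) cs) (hit (j + d) cs))
      (trans (contentSum-+ n e (λ cs → o cs + o cs * a cs) (λ cs → o cs * b cs + o cs * (a cs * b cs)))
        (cong₂ _+_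
          (trans (contentSum-+ n e o (λ cs → o cs * a cs)) (cong (f d e +_)
            (contentSum-hit n e (y + d) (i + d) (+-monoˡ-< d (≤-<-trans i≤j j<y)) eq′)))
          (trans (contentSum-+ n e (λ cs → o cs * b cs) (λ cs → o cs * (a cs * b cs)))
            (cong₂ _+_ (contentSum-hit n e (y + d) (j + d) (+-monoˡ-< d j<y) eq′)
                       (contentSum-hit-hit n e (y + d) (i + d) (j + d) (+-monoˡ-≤ d i≤j) (+-monoˡ-< d j<y) eq′)))))
      where
      o a b : Vec ℕ n → ℕ
      o = ok (y + d)
      a = hit (i + d)
      b = hit (j + d)
      eq′ = shift y d e eq d+e≡m

-- The outcome of parking as a function of the content.

module Parking where

  open ContentSums
  open import Data.Nat
  open import Data.Nat.Properties

  private
    variable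
      m n : ℕ
      A B : Set

  -- The occupied spots when c cars prefer each spot and h further cars arrive from
  -- the left; over counts the cars that are pushed out at the right end.
  occ : ℕ → Vec ℕ n → Subset n
  occBelow : ℕ → Vec ℕ n → Subset (suc n)
  occ h []       = []
  occ h (c ∷ cs) = occBelow (h + c) cs
  occBelow zero    cs = outside ∷ occ 0 cs
  occBelow (suc h) cs = inside ∷ occ h cs

  over : ℕ → Vec ℕ n → ℕ
  over h []       = h
  over h (c ∷ cs) = over (pred (h + c)) cs

  -- `firstFree` with a numerical threshold in place of the preferred spot, so that it recurs along
  -- the street.
  free : ℕ → Subset n → Maybe (Fin n)
  free ℓ       []            = nothing
  free zero    (outside ∷ O) = just zero
  free zero    (inside ∷ O)  = Maybe.map suc (free zero O)
  free (suc ℓ) (_ ∷ O)       = Maybe.map suc (free ℓ O)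

  filter-map : ∀ {P : Pred B 0ℓ} (P? : Decidable P) (f : A → B) xs →
               filter P? (List.map f xs) ≡ List.map f (filter (P? ∘ f) xs)
  filter-map P? f []       = refl
  filter-map P? f (x ∷ xs) with does (P? (f x))
  ... | true  = cong (f x ∷_) (filter-map P? f xs)
  ... | false = filter-map P? f xs

  filter-tabulate-suc : ∀ {P : Pred (Fin (suc n)) 0ℓ} (P? : Decidable P) →
                        filter P? (tabulate suc) ≡ List.map suc (filter (P? ∘ suc) (allFin n))
  filter-tabulate-suc P? =
    trans (cong (filter P?) (sym (map-tabulate id suc))) (filter-map P? suc (allFin _))

  firstFree≡free : ∀ ℓ (O : Subset n) →
    head (filter (λ s → (ℓ ≤? toℕ s) ×-dec ¬? (s ∈? O)) (allFin n)) ≡ free ℓ O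
  firstFree≡free ℓ []      = refl
  firstFree≡free zero    (outside ∷ O) = refl
  firstFree≡free {suc n} zero (inside ∷ O) = begin
    head (filter P? (tabulate suc))                 ≡⟨ cong head (filter-tabulate-suc P?) ⟩
    head (List.map suc (filter (P? ∘ suc) (allFin n))) ≡⟨ head-map (filter (P? ∘ suc) (allFin n)) ⟩
    Maybe.map suc (head (filter (P? ∘ suc) (allFin n)))
      ≡⟨ cong (Maybe.map suc ∘ head) (filter-≐ (P? ∘ suc) Q?
           ((λ (_ , s∉) → z≤n , s∉ ∘ Vec.there) , (λ (_ , s∉) → z≤n , s∉ ∘ drop-there)) (allFin n)) ⟩
    Maybe.map suc (head (filter Q? (allFin n)))     ≡⟨ cong (Maybe.map suc) (firstFree≡free zero O) ⟩
    Maybe.map suc (free zero O)                     ∎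
    where
    open ≡-Reasoning
    P? = λ (s : Fin (suc n)) → (0 ≤? toℕ s) ×-dec ¬? (s ∈? (inside ∷ O))
    Q? = λ (s : Fin n) → (0 ≤? toℕ s) ×-dec ¬? (s ∈? O)
  firstFree≡free {suc n} (suc ℓ) (b ∷ O) = begin
    head (filter P? (tabulate suc))                 ≡⟨ cong head (filter-tabulate-suc P?) ⟩
    head (List.map suc (filter (P? ∘ suc) (allFin n))) ≡⟨ head-map (filter (P? ∘ suc) (allFin n)) ⟩
    Maybe.map suc (head (filter (P? ∘ suc) (allFin n)))
      ≡⟨ cong (Maybe.map suc ∘ head) (filter-≐ (P? ∘ suc) Q?
           ((λ (ℓ≤s , s∉) → s≤s⁻¹ ℓ≤s , s∉ ∘ Vec.there) , (λ (ℓ≤s , s∉) → s≤s ℓ≤s , s∉ ∘ drop-there)) (allFin n)) ⟩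
    Maybe.map suc (head (filter Q? (allFin n)))     ≡⟨ cong (Maybe.map suc) (firstFree≡free ℓ O) ⟩
    Maybe.map suc (free ℓ O)                        ∎
    where
    open ≡-Reasoning
    P? = λ (s : Fin (suc n)) → (suc ℓ ≤? toℕ s) ×-dec ¬? (s ∈? (b ∷ O))
    Q? = λ (s : Fin n) → (ℓ ≤? toℕ s) ×-dec ¬? (s ∈? O)

  free≡firstFree : ∀ (O : Subset n) p → free (toℕ p) O ≡ firstFree O p
  free≡firstFree O p = sym (firstFree≡free (toℕ p) O)

  map-suc-just : ∀ (x : Maybe (Fin n)) {s} → Maybe.map Fin.suc x ≡ just s → ∃ λ r → s ≡ suc r × x ≡ just r
  map-suc-just (just r) refl = r , refl , refl

  map-suc-nothing : ∀ (x : Maybe (Fin n)) → Maybe.map Fin.suc x ≡ nothing → x ≡ nothing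
  map-suc-nothing nothing refl = refl

  free-lower : ∀ ℓ (O : Subset n) {s} → free ℓ O ≡ just s → ℓ ≤ toℕ s
  free-lower zero    O       eq = z≤n
  free-lower (suc ℓ) (_ ∷ O) eq with map-suc-just (free ℓ O) eq
  ... | r , refl , eq′ = s≤s (free-lower ℓ O eq′)

  free-least : ∀ ℓ (O : Subset n) {s} t → free ℓ O ≡ just s → ℓ ≤ toℕ t → toℕ t ≤ toℕ s → t ∈ O ⊎ t ≡ s
  free-least zero    (outside ∷ O) zero    refl _ _ = inj₂ refl
  free-least zero    (inside ∷ O)  zero    eq   _ _ = inj₁ Vec.here
  free-least zero    (inside ∷ O)  (suc t) eq   _ t≤s with map-suc-just (free zero O) eq
  ... | r , refl , eq′ with free-least zero O t eq′ z≤n (s≤s⁻¹ t≤s)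
  ...   | inj₁ t∈O = inj₁ (Vec.there t∈O)
  ...   | inj₂ t≡r = inj₂ (cong suc t≡r)
  free-least (suc ℓ) (_ ∷ O)       (suc t) eq ℓ≤t t≤s with map-suc-just (free ℓ O) eq
  ... | r , refl , eq′ with free-least ℓ O t eq′ (s≤s⁻¹ ℓ≤t) (s≤s⁻¹ t≤s)
  ...   | inj₁ t∈O = inj₁ (Vec.there t∈O)
  ...   | inj₂ t≡r = inj₂ (cong suc t≡r)

  inc : Fin n → Vec ℕ n → Vec ℕ n
  inc zero    (c ∷ cs) = suc c ∷ cs
  inc (suc p) (c ∷ cs) = c ∷ inc p cs

  -- One more car in the carry finds every spot filled up to the first gap, takes that gap, and
  -- leaves the carry beyond it as before.
  push-just : ∀ h (cs : Vec ℕ n) {s} → free zero (occ h cs) ≡ just s →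
              occ (suc h) cs ≡ occ h cs ∪ ⁅ s ⁆ × over (suc h) cs ≡ over h cs
  push-just h (c ∷ cs) eq with h + c
  push-just h (c ∷ cs) refl | zero  = cong (inside ∷_) (sym (∪-identityʳ (occ 0 cs))) , refl
  push-just h (c ∷ cs) eq   | suc g with map-suc-just (free zero (occ g cs)) eq
  ... | r , refl , eq′ with push-just g cs eq′
  ...   | occ≡ , over≡ = cong (inside ∷_) occ≡ , over≡

  push-nothing : ∀ h (cs : Vec ℕ n) → free zero (occ h cs) ≡ nothing → over (suc h) cs ≡ suc (over h cs)
  push-nothing h []       eq = refl
  push-nothing h (c ∷ cs) eq with h + c
  ... | suc g = push-nothing g cs (map-suc-nothing (free zero (occ g cs)) eq)

  -- Nothing changes before `p`, and at `p` an extra preference acts like an extra carried car. This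
  -- is what makes the occupied set independent of the order of the cars.
  inc-just : ∀ h p (cs : Vec ℕ n) {s} → free (toℕ p) (occ h cs) ≡ just s →
             occ h (inc p cs) ≡ occ h cs ∪ ⁅ s ⁆ × over h (inc p cs) ≡ over h cs
  inc-just h zero (c ∷ cs) eq rewrite +-suc h c = push-just h (c ∷ cs) eq
  inc-just h (suc p) (c ∷ cs) eq with h + c
  ... | zero  with map-suc-just (free (toℕ p) (occ 0 cs)) eq
  ...   | r , refl , eq′ with inc-just 0 p cs eq′
  ...     | occ≡ , over≡ = cong (outside ∷_) occ≡ , over≡
  inc-just h (suc p) (c ∷ cs) eq | suc g with map-suc-just (free (toℕ p) (occ g cs)) eq
  ...   | r , refl , eq′ with inc-just g p cs eq′
  ...     | occ≡ , over≡ = cong (inside ∷_) occ≡ , over≡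

  inc-nothing : ∀ h p (cs : Vec ℕ n) → free (toℕ p) (occ h cs) ≡ nothing → over h (inc p cs) ≡ suc (over h cs)
  inc-nothing h zero (c ∷ cs) eq rewrite +-suc h c = push-nothing h (c ∷ cs) eq
  inc-nothing h (suc p) (c ∷ cs) eq with h + c
  ... | zero  = inc-nothing 0 p cs (map-suc-nothing (free (toℕ p) (occ 0 cs)) eq)
  ... | suc g = inc-nothing g p cs (map-suc-nothing (free (toℕ p) (occ g cs)) eq)

  over-inc : ∀ p (cs : Vec ℕ n) → over 0 cs ≤ over 0 (inc p cs)
  over-inc p cs with free (toℕ p) (occ 0 cs) in eq
  ... | just s  = ≤-reflexive (sym (proj₂ (inc-just 0 p cs eq)))
  ... | nothing = ≤-trans (n≤1+n _) (≤-reflexive (sym (inc-nothing 0 p cs eq)))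

  load : Vec ℕ n → Vec (Fin n) m → Vec ℕ n
  load cs []      = cs
  load cs (p ∷ π) = load (inc p cs) π

  over-load : ∀ (cs : Vec ℕ n) (π : Vec (Fin n) m) → over 0 cs ≤ over 0 (load cs π)
  over-load cs []      = ≤-refl
  over-load cs (p ∷ π) = ≤-trans (over-inc p cs) (over-load (inc p cs) π)

  -- The invariant for parking `π` on top of the cars in `cs`. The intervals are those of
  -- `Attempted`, so for empty `cs` it identifies attempted spots with occupied ones.
  Outcome : Vec ℕ n → Vec (Fin n) m → Maybe (Vec (Fin n) m) → Set
  Outcome cs π nothing  = over 0 (load cs π) ≢ 0
  Outcome cs π (just s) = over 0 (load cs π) ≡ 0 × ∀ t →
    (t ∈ occ 0 (load cs π) → t ∈ occ 0 cs ⊎ ∃ λ car → lookup π car Fin.≤ t × t Fin.≤ lookup s car) ×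
    (t ∈ occ 0 cs ⊎ (∃ λ car → lookup π car Fin.≤ t × t Fin.≤ lookup s car) → t ∈ occ 0 (load cs π))

  parkFrom-outcome : (cs : Vec ℕ n) (π : Vec (Fin n) m) → over 0 cs ≡ 0 →
                     Outcome cs π (parkFrom (occ 0 cs) π)
  parkFrom-outcome cs []      fits = fits , λ t → inj₁ , λ { (inj₁ t∈) → t∈ ; (inj₂ (() , _)) }
  parkFrom-outcome cs (p ∷ π) fits
    with firstFree (occ 0 cs) p | free≡firstFree (occ 0 cs) p
  -- This car is pushed out, so `over` is already positive, and later cars cannot lower it.
  ... | nothing | eq = λ fits′ → contradiction
        (≤-trans (≤-reflexive (sym (inc-nothing 0 p cs eq))) (≤-trans (over-load (inc p cs) π) (≤-reflexive fits′)))
        λ ()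
  ... | just s  | eq with inc-just 0 p cs eq
  ...   | occ≡ , over≡
    with parkFrom (occ 0 cs ∪ ⁅ s ⁆) π
       | subst (λ O → Outcome (inc p cs) π (parkFrom O π)) occ≡ (parkFrom-outcome (inc p cs) π (trans over≡ fits))
  ...     | nothing | unparked = unparked
  ...     | just ss | fits′ , final = fits′ , λ t → to t , from t
    where
    Covered : Fin _ → Set
    Covered t = ∃ λ car → lookup (p ∷ π) car Fin.≤ t × t Fin.≤ lookup (s ∷ ss) car
    to : ∀ t → t ∈ occ 0 (load (inc p cs) π) → t ∈ occ 0 cs ⊎ Covered t
    to t t∈ with proj₁ (final t) t∈
    ... | inj₂ (car , p≤t , t≤s) = inj₂ (suc car , p≤t , t≤s)
    ... | inj₁ t∈inc with x∈p∪q⁻ (occ 0 cs) ⁅ s ⁆ (subst (t ∈_) occ≡ t∈inc)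
    ...   | inj₁ t∈cs = inj₁ t∈cs
    ...   | inj₂ t∈s with x∈⁅y⁆⇒x≡y s t∈s
    ...     | refl = inj₂ (zero , free-lower (toℕ p) (occ 0 cs) eq , ≤-refl)
    add : ∀ {t} → t ∈ occ 0 cs ⊎ t ∈ ⁅ s ⁆ → t ∈ occ 0 (inc p cs)
    add t∈ = subst (_ ∈_) (sym occ≡) (x∈p∪q⁺ t∈)
    from : ∀ t → t ∈ occ 0 cs ⊎ Covered t → t ∈ occ 0 (load (inc p cs) π)
    from t (inj₁ t∈cs) = proj₂ (final t) (inj₁ (add (inj₁ t∈cs)))
    from t (inj₂ (suc car , p≤t , t≤s)) = proj₂ (final t) (inj₂ (car , p≤t , t≤s))
    -- The spots that the first car tries before `s` were occupied already, so its attempts add only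
    -- `s`.
    from t (inj₂ (zero , p≤t , t≤s)) with free-least (toℕ p) (occ 0 cs) t eq p≤t t≤s
    ... | inj₁ t∈cs = proj₂ (final t) (inj₁ (add (inj₁ t∈cs)))
    ... | inj₂ refl = proj₂ (final t) (inj₁ (add (inj₂ (x∈⁅x⁆ t))))

  empty : ∀ n → Vec ℕ n
  empty n = replicate n 0

  occ-empty : ∀ n → occ 0 (empty n) ≡ ⊥
  occ-empty zero    = refl
  occ-empty (suc n) = cong (outside ∷_) (occ-empty n)

  over-empty : ∀ n → over 0 (empty n) ≡ 0
  over-empty zero    = refl
  over-empty (suc n) = over-empty n

  content : Vec (Fin n) m → Vec ℕ n
  content = load (empty _)

  park-outcome : (π : Vec (Fin n) m) → Outcome (empty n) π (park π)
  park-outcome {n} π =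
    subst (λ O → Outcome (empty n) π (parkFrom O π)) (occ-empty n) (parkFrom-outcome (empty n) π (over-empty n))

  parking⇒fits : (π : Vec (Fin n) m) → IsParking π → over 0 (content π) ≡ 0
  parking⇒fits π parks with park π | park-outcome π
  parking⇒fits π (just _) | just s | fits , _ = fits

  ¬parking⇒¬fits : (π : Vec (Fin n) m) → ¬ IsParking π → over 0 (content π) ≢ 0
  ¬parking⇒¬fits π ¬parks with park π | park-outcome π
  ... | just s  | _       = contradiction (just tt) ¬parks
  ... | nothing | ¬fits   = ¬fits

  unattempted≡ : (π : Vec (Fin n) m) → IsParking π →
                 unattempted π ≡ filter (λ t → ¬? (t ∈? occ 0 (content π))) (allFin n)
  unattempted≡ {n} π parks = filter-≐ (λ t → ¬? (attempted? π t)) _ (unatt⇒ , unatt⇐) (allFin n)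
    where
    attempted⇔ : IsParking π → ∀ t → (Attempted π t → t ∈ occ 0 (content π)) × (t ∈ occ 0 (content π) → Attempted π t)
    attempted⇔ parks t with park π | park-outcome π
    attempted⇔ (just _) t | just s | _ , final = (λ { (just c) → proj₂ (final t) (inj₂ c) }) , to
      where
      to : t ∈ occ 0 (content π) → Any _ (just s)
      to t∈ with proj₁ (final t) t∈
      ... | inj₁ t∈⊥ = contradiction (subst (t ∈_) (occ-empty n) t∈⊥) ∉⊥
      ... | inj₂ c   = just c
    unatt⇒ : ∀ {t} → ¬ Attempted π t → t ∉ occ 0 (content π)
    unatt⇒ {t} ¬att t∈ = ¬att (proj₂ (attempted⇔ parks t) t∈)
    unatt⇐ : ∀ {t} → t ∉ occ 0 (content π) → ¬ Attempted π t
    unatt⇐ {t} t∉ att = t∉ (proj₁ (attempted⇔ parks t) att)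

  -- Gaps as hitting times, and overflow as failure of positivity.

  gaps : Subset n → List (Fin n)
  gaps []            = []
  gaps (outside ∷ O) = zero ∷ List.map suc (gaps O)
  gaps (inside ∷ O)  = List.map suc (gaps O)

  filter-∉≡gaps : (O : Subset n) → filter (λ t → ¬? (t ∈? O)) (allFin n) ≡ gaps O
  filter-∉≡gaps []      = refl
  filter-∉≡gaps {suc n} (b ∷ O) = helper b
    where
    open ≡-Reasoning
    rest : ∀ b → filter (λ t → ¬? (t ∈? (b ∷ O))) (tabulate suc) ≡ List.map suc (gaps O)
    rest b = begin
      filter P? (tabulate suc)                      ≡⟨ filter-tabulate-suc P? ⟩
      List.map suc (filter (P? ∘ suc) (allFin n))   ≡⟨ cong (List.map suc) (filter-≐ (P? ∘ suc) _
        ((_∘ Vec.there) , (_∘ drop-there)) (allFin n)) ⟩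
      List.map suc (filter (λ t → ¬? (t ∈? O)) (allFin n)) ≡⟨ cong (List.map suc) (filter-∉≡gaps O) ⟩
      List.map suc (gaps O)                         ∎
      where P? = λ (t : Fin (suc n)) → ¬? (t ∈? (b ∷ O))
    helper : ∀ b → filter (λ t → ¬? (t ∈? (b ∷ O))) (allFin (suc n)) ≡ gaps (b ∷ O)
    helper inside  = rest inside
    helper outside = cong (zero ∷_) (rest outside)

  -- Conservation: a spot is a gap or holds one car, and a car holds a spot or overflows.
  length-gaps : ∀ h (cs : Vec ℕ n) → length (gaps (occ h cs)) + (h + Vec.sum cs) ≡ n + over h cs
  length-gaps h []       = +-identityʳ h
  length-gaps h (c ∷ cs) rewrite sym (+-assoc h c (Vec.sum cs)) with h + c
  ... | zero  = cong suc (trans (cong (_+ Vec.sum cs) (length-map suc (gaps (occ 0 cs)))) (length-gaps 0 cs))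
  ... | suc g = trans (+-suc _ _)
    (cong suc (trans (cong (_+ (g + Vec.sum cs)) (length-map suc (gaps (occ g cs)))) (length-gaps g cs)))

  positions : Subset n → List ℕ
  positions O = List.map (λ t → suc (toℕ t)) (gaps O)

  nth-shift : ∀ i (O : Subset n) {x} → head (drop i (positions O)) ≡ just x →
              head (drop i (List.map (λ t → suc (toℕ t)) (List.map Fin.suc (gaps O)))) ≡ just (suc x)
  nth-shift i O {x} eq = begin
    head (drop i (List.map (λ t → suc (toℕ t)) (List.map suc (gaps O))))
      ≡⟨ cong (head ∘ drop i) (trans (sym (map-∘ (gaps O))) (map-∘ (gaps O))) ⟩
    head (drop i (List.map suc (positions O)))   ≡⟨ cong head (drop-map i (positions O)) ⟩
    head (List.map suc (drop i (positions O)))   ≡⟨ head-map (drop i (positions O)) ⟩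
    Maybe.map suc (head (drop i (positions O)))  ≡⟨ cong (Maybe.map suc) eq ⟩
    just (suc x)                                 ∎
    where open ≡-Reasoning

  -- At each spot the walk exceeds the carry `h` by one plus the number `i` of gaps still to be
  -- skipped. A spot with `h + c = 0` is a gap and uses up one of them; the walk reaches 0 exactly
  -- at the gap met with `i = 0`.
  nth-gap : ∀ i h (cs : Vec ℕ n) → i < length (gaps (occ h cs)) →
            head (drop i (positions (occ h cs))) ≡ just (hit (suc (h + i)) cs)
  nth-gap i h (c ∷ cs) i<
    -- Exposes `h + c` inside the argument of `hit`, so that the case split acts on the walk as
    -- well.
    rewrite trans (+-assoc h i c) (trans (cong (h +_) (+-comm i c)) (sym (+-assoc h c i)))
    with h + c
  nth-gap zero    h (c ∷ cs) i< | zero = refl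
  nth-gap (suc i) h (c ∷ cs) (s≤s i<) | zero = nth-shift i (occ 0 cs)
    (nth-gap i 0 cs (subst (i <_) (length-map suc (gaps (occ 0 cs))) i<))
  nth-gap i       h (c ∷ cs) i< | suc g = nth-shift i (occ g cs)
    (nth-gap i g cs (subst (i <_) (length-map suc (gaps (occ g cs))) i<))

  sum-inc : ∀ p (cs : Vec ℕ n) → Vec.sum (inc p cs) ≡ suc (Vec.sum cs)
  sum-inc zero    (c ∷ cs) = refl
  sum-inc (suc p) (c ∷ cs) = trans (cong (c +_) (sum-inc p cs)) (+-suc c (Vec.sum cs))

  sum-load : ∀ (cs : Vec ℕ n) (π : Vec (Fin n) m) → Vec.sum (load cs π) ≡ m + Vec.sum cs
  sum-load cs []      = refl
  sum-load {m = suc m} cs (p ∷ π) =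
    trans (sum-load (inc p cs) π) (trans (cong (m +_) (sum-inc p cs)) (+-suc m (Vec.sum cs)))

  sum-empty : ∀ n → Vec.sum (empty n) ≡ 0
  sum-empty zero    = refl
  sum-empty (suc n) = sum-empty n

  sum-content : (π : Vec (Fin n) m) → Vec.sum (content π) ≡ m
  sum-content {n} {m} π = trans (sum-load (empty n) π) (trans (cong (m +_) (sum-empty n)) (+-identityʳ m))

  -- Parking leaves `n ∸ m` gaps by `length-gaps`, so the bound on `i` keeps `k` away from its
  -- default value.
  k≡hit : ∀ i (π : Vec (Fin n) m) → IsParking π → i < n ∸ m → k (suc i) π ≡ hit (suc i) (content π)
  k≡hit {n} {m} i π parks i<n∸m = trans
    (cong (λ ts → fromMaybe 0 (head (drop i (List.map (λ t → suc (toℕ t)) ts))))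
      (trans (unattempted≡ π parks) (filter-∉≡gaps (occ 0 (content π)))))
    (cong (fromMaybe 0) (nth-gap i 0 (content π) (subst (i <_) (sym #gaps) i<n∸m)))
    where
    #gaps : length (gaps (occ 0 (content π))) ≡ n ∸ m
    #gaps = trans (sym (m+n∸n≡m _ m)) (cong (_∸ m)
      (trans (cong (length (gaps (occ 0 (content π))) +_) (sym (sum-content π)))
      (trans (length-gaps 0 (content π)) (trans (cong (n +_) (parking⇒fits π parks)) (+-identityʳ n)))))

  ok⇒0< : ∀ y (cs : Vec ℕ n) → ok y cs ≢ 0 → 0 < y
  ok⇒0< zero    cs ok≢0 = contradiction refl ok≢0
  ok⇒0< (suc y) cs ok≢0 = z<s

  ok-0-1 : ∀ y (cs : Vec ℕ n) → ok y cs ≡ 0 ⊎ ok y cs ≡ 1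
  ok-0-1 zero          cs       = inj₁ refl
  ok-0-1 (suc zero)    []       = inj₂ refl
  ok-0-1 (suc (suc y)) []       = inj₁ refl
  ok-0-1 (suc y)       (c ∷ cs) = ok-0-1 (y + c) cs

  over-mass : ∀ h (cs : Vec ℕ n) → h + Vec.sum cs ≤ n + over h cs
  over-mass h cs = subst (h + Vec.sum cs ≤_) (length-gaps h cs) (m≤n+m (h + Vec.sum cs) (length (gaps (occ h cs))))

  -- A walk at 0 would mean one more car to come than spots left, hence an overflow whatever the
  -- carry.
  fits⇒ok : ∀ h y (cs : Vec ℕ n) → y + Vec.sum cs ≡ suc n → over h cs ≡ 0 → ok y cs ≡ 1
  fits⇒ok {zero}  h (suc zero)    []  eq   fits = refl
  fits⇒ok {zero}  h (suc (suc y)) []  ()   fits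
  fits⇒ok {suc n} h zero (c ∷ cs) eq fits = contradiction
    (≤-trans (≤-reflexive (sym eq)) (≤-trans (m≤n+m _ h)
      (≤-trans (over-mass h (c ∷ cs)) (≤-reflexive (trans (cong (suc n +_) fits) (+-identityʳ (suc n)))))))
    1+n≰n
  fits⇒ok {suc n} h (suc y) (c ∷ cs) eq fits =
    fits⇒ok (pred (h + c)) (y + c) cs (trans (+-assoc y c (Vec.sum cs)) (suc-injective eq)) fits

  -- The bound `h + Vec.sum cs ≤ n` says that the remaining cars fit in number, and at the right end
  -- it forces the carry to be 0. After an empty spot it is the positivity of the walk that restores
  -- it.
  ok⇒fits : ∀ h y (cs : Vec ℕ n) → y + Vec.sum cs ≡ suc n → h + Vec.sum cs ≤ n → ok y cs ≢ 0 → over h cs ≡ 0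
  ok⇒fits h y [] eq h≤0 ok≢0 = n≤0⇒n≡0 (≤-trans (m≤m+n h 0) h≤0)
  ok⇒fits h zero (c ∷ cs) eq h≤ ok≢0 = contradiction refl ok≢0
  ok⇒fits {suc n} h (suc y) (c ∷ cs) eq h≤ ok≢0 =
    ok⇒fits (pred (h + c)) (y + c) cs eq′ (mass (h + c) (subst (_≤ suc n) (sym (+-assoc h c (Vec.sum cs))) h≤)) ok≢0
    where
    eq′ = trans (+-assoc y c (Vec.sum cs)) (suc-injective eq)
    mass : ∀ g → g + Vec.sum cs ≤ suc n → pred g + Vec.sum cs ≤ n
    mass zero    _ = s≤s⁻¹ (≤-trans (+-monoˡ-≤ (Vec.sum cs) (ok⇒0< (y + c) cs ok≢0)) (≤-reflexive eq′))
    mass (suc g) p = s≤s⁻¹ p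

  -- Sums over parking functions as weighted content sums.

  total : (A → ℕ) → List A → ℕ
  total f []       = 0
  total f (x ∷ xs) = f x + total f xs

  total-cong : ∀ {f g : A → ℕ} xs → (∀ x → f x ≡ g x) → total f xs ≡ total g xs
  total-cong []       f≗g = refl
  total-cong (x ∷ xs) f≗g = cong₂ _+_ (f≗g x) (total-cong xs f≗g)

  total-++ : ∀ (f : A → ℕ) xs ys → total f (xs ++ ys) ≡ total f xs + total f ys
  total-++ f []       ys = refl
  total-++ f (x ∷ xs) ys = trans (cong (f x +_) (total-++ f xs ys)) (sym (+-assoc (f x) _ _))

  total-map : ∀ (f : B → ℕ) (g : A → B) xs → total f (List.map g xs) ≡ total (f ∘ g) xs
  total-map f g []       = refl
  total-map f g (x ∷ xs) = cong (f (g x) +_) (total-map f g xs)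

  total-cartesianProductWith : ∀ {C : Set} (f : C → ℕ) (g : A → B → C) xs ys →
    total f (cartesianProductWith g xs ys) ≡ total (λ x → total (λ y → f (g x y)) ys) xs
  total-cartesianProductWith f g []       ys = refl
  total-cartesianProductWith f g (x ∷ xs) ys = trans (total-++ f (List.map (g x) ys) _)
    (cong₂ _+_ (total-map f (g x) ys) (total-cartesianProductWith f g xs ys))

  total-tabulate-suc : ∀ (f : Fin (suc n) → ℕ) → total f (tabulate suc) ≡ total (f ∘ suc) (allFin n)
  total-tabulate-suc f = trans (cong (total f) (sym (map-tabulate id suc))) (total-map f suc (allFin _))

  total-filter : ∀ {P : Pred A 0ℓ} (P? : Decidable P) {f g : A → ℕ} →
    (∀ x → P x → f x ≡ g x) → (∀ x → ¬ P x → g x ≡ 0) → ∀ xs → total f (filter P? xs) ≡ total g xs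
  total-filter P? P⇒ ¬P⇒ []       = refl
  total-filter P? {g = g} P⇒ ¬P⇒ (x ∷ xs) with P? x
  ... | yes px = cong₂ _+_ (P⇒ x px) (total-filter P? P⇒ ¬P⇒ xs)
  ... | no ¬px = trans (total-filter P? P⇒ ¬P⇒ xs) (cong (_+ total g xs) (sym (¬P⇒ x ¬px)))

  split-total : ∀ m (F : A → ℕ → ℕ → ℕ) xs →
                total (λ x → split m (F x)) xs ≡ split m (λ d e → total (λ x → F x d e) xs)
  split-total m F []       = sym (split-0 m)
  split-total m F (x ∷ xs) = trans (cong (split m (F x) +_) (split-total m F xs))
    (sym (split-+ m (F x) (λ d e → total (λ x → F x d e) xs)))

  contentSum-empty : ∀ n g → contentSum n 0 g ≡ g (empty n)
  contentSum-empty zero    g = refl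
  contentSum-empty (suc n) g = contentSum-empty n (λ cs → g (0 ∷ cs))

  -- The two summands of `split (suc m)` match the new car preferring the first spot or a later one.
  contentSum-inc : ∀ n m g → total (λ p → contentSum n m (g ∘ inc p)) (allFin n) ≡ contentSum n (suc m) g
  contentSum-inc zero    m g = refl
  contentSum-inc (suc n) m g = cong (split m (λ d e → contentSum n e (λ cs → g (suc d ∷ cs))) +_) (begin
    total (λ p → contentSum (suc n) m (g ∘ inc p)) (tabulate suc)
      ≡⟨ total-tabulate-suc (λ p → contentSum (suc n) m (g ∘ inc p)) ⟩
    total (λ p → split m (λ d e → contentSum n e (λ cs → g (d ∷ inc p cs)))) (allFin n)
      ≡⟨ split-total m (λ p d e → contentSum n e (λ cs → g (d ∷ inc p cs))) (allFin n) ⟩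
    split m (λ d e → total (λ p → contentSum n e (λ cs → g (d ∷ inc p cs))) (allFin n))
      ≡⟨ split-cong′ m (λ d e → contentSum-inc n e (λ cs → g (d ∷ cs))) ⟩
    split m (λ d e → contentSum n (suc e) (λ cs → g (d ∷ cs))) ∎)
    where open ≡-Reasoning

  inc-comm : ∀ p q (cs : Vec ℕ n) → inc p (inc q cs) ≡ inc q (inc p cs)
  inc-comm zero    zero    (c ∷ cs) = refl
  inc-comm zero    (suc q) (c ∷ cs) = refl
  inc-comm (suc p) zero    (c ∷ cs) = refl
  inc-comm (suc p) (suc q) (c ∷ cs) = cong (c ∷_) (inc-comm p q cs)

  load-inc : ∀ p (cs : Vec ℕ n) (π : Vec (Fin n) m) → load (inc p cs) π ≡ inc p (load cs π)
  load-inc p cs []      = refl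
  load-inc p cs (q ∷ π) = trans (cong (λ cs → load cs π) (inc-comm q p cs)) (load-inc p (inc q cs) π)

  total-preferences : ∀ m n g → total (g ∘ content) (preferences m n) ≡ contentSum n m g
  total-preferences zero    n g = trans (+-identityʳ _) (sym (contentSum-empty n g))
  total-preferences (suc m) n g = begin
    total (g ∘ content) (preferences (suc m) n)
      ≡⟨ total-cartesianProductWith (g ∘ content) _∷_ (allFin n) (preferences m n) ⟩
    total (λ p → total (λ π → g (content (p ∷ π))) (preferences m n)) (allFin n)
      ≡⟨ total-cong (allFin n) (λ p → trans
           (total-cong (preferences m n) (λ π → cong g (load-inc p (empty n) π)))
           (total-preferences m n (g ∘ inc p))) ⟩
    total (λ p → contentSum n m (g ∘ inc p)) (allFin n)
      ≡⟨ contentSum-inc n m g ⟩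
    contentSum n (suc m) g ∎
    where open ≡-Reasoning

  -- The weight `ok` is the indicator of parking, so `f` has to match `g` only on parking functions,
  -- which is where `k` and `hit` agree.
  total-PF : ∀ m n y → y + m ≡ suc n → m ≤ n → (f : Vec (Fin n) m → ℕ) (g : Vec ℕ n → ℕ) →
    (∀ π → IsParking π → f π ≡ g (content π)) →
    total f (PF m n) ≡ contentSum n m (λ cs → ok y cs * g cs)
  total-PF m n y eq m≤n f g f≡g =
    trans (total-filter isParking? parking ¬parking (preferences m n)) (total-preferences m n λ cs → ok y cs * g cs)
    where
    eq′ : (π : Vec (Fin n) m) → y + Vec.sum (content π) ≡ suc n
    eq′ π = trans (cong (y +_) (sum-content π)) eq
    parking : ∀ π → IsParking π → f π ≡ ok y (content π) * g (content π)
    parking π parks rewrite fits⇒ok 0 y (content π) (eq′ π) (parking⇒fits π parks) =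
      trans (f≡g π parks) (sym (*-identityˡ _))
    ¬parking : ∀ π → ¬ IsParking π → ok y (content π) * g (content π) ≡ 0
    ¬parking π ¬parks with ok-0-1 y (content π)
    ... | inj₁ ok≡0 = cong (_* g (content π)) ok≡0
    ... | inj₂ ok≡1 = contradiction
      (ok⇒fits 0 y (content π) (eq′ π) (≤-trans (≤-reflexive (sum-content π)) m≤n) (λ ok≡0 → 1+n≢0 (trans (sym ok≡1) ok≡0)))
      (¬parking⇒¬fits π ¬parks)

-- Recurrences for `Q`, `Z`, `Z₂` and bounds with explicit relative error.

module Estimates where

  open ContentSums
  open import Data.Nat
  open import Data.Nat.Properties

  -- A telescoping sum: with `a(k) = m(m-1)...(m-k+1) N^(m-k)`, the relations `y + k = N - (m - k)`
  -- and `(m - k) a(k) = N a(k+1)` give `(y + k) a(k) = N a(k) - N a(k+1)`. The induction passes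
  -- from `(y, m + 1)` to `(y + 1, m)` with `N` fixed.
  y*Q+Z : ∀ m y N → y + m ≡ N → y * Q N m + Z N m ≡ N * N ^ m
  y*Q+Z zero    y N refl = ring y
    where
    ring : ∀ y → y * 1 + 0 ≡ (y + 0) * 1
    ring = solve-∀
  y*Q+Z (suc m) y N eq   = begin
    y * (N ^ suc m + suc m * Q N m) + suc m * (Z N m + Q N m)
      ≡⟨ ring y (N ^ suc m) (suc m) (Q N m) (Z N m) ⟩
    y * N ^ suc m + suc m * (suc y * Q N m + Z N m)
      ≡⟨ cong (λ s → y * N ^ suc m + suc m * s) (y*Q+Z m (suc y) N (trans (sym (+-suc y m)) eq)) ⟩
    y * N ^ suc m + suc m * N ^ suc m
      ≡⟨ *-distribʳ-+ (N ^ suc m) y (suc m) ⟨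
    (y + suc m) * N ^ suc m
      ≡⟨ cong (_* N ^ suc m) eq ⟩
    N * N ^ suc m ∎
    where
    open ≡-Reasoning
    ring : ∀ y p m Q Z → y * (p + m * Q) + m * (Z + Q) ≡ y * p + m * (suc y * Q + Z)
    ring = solve-∀

  -- Eliminating Q between this and y*Q+Z shows that y² Z is m Nᵐ⁺¹ up to lower order terms.
  y*Z+Z₂ : ∀ m y N → y + m ≡ N → y * Z N m + Z₂ N m + N * N ^ m ≡ N * Q N m
  y*Z+Z₂ zero    y N eq = cong (λ s → s + 0 + N * 1) (*-zeroʳ y)
  y*Z+Z₂ (suc m) y N eq = begin
    y * (suc m * (Z N m + Q N m)) + suc m * (Z₂ N m + 2 * Z N m + Q N m) + N * N ^ suc m
      ≡⟨ ring₁ y (suc m) (Q N m) (Z N m) (Z₂ N m) (N * N ^ suc m) ⟩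
    suc m * (suc y * Z N m + Z₂ N m + (suc y * Q N m + Z N m)) + N * N ^ suc m
      ≡⟨ cong (λ s → suc m * (suc y * Z N m + Z₂ N m + s) + N * N ^ suc m) (y*Q+Z m (suc y) N eq′) ⟩
    suc m * (suc y * Z N m + Z₂ N m + N * N ^ m) + N * N ^ suc m
      ≡⟨ cong (λ s → suc m * s + N * N ^ suc m) (y*Z+Z₂ m (suc y) N eq′) ⟩
    suc m * (N * Q N m) + N * N ^ suc m
      ≡⟨ ring₂ (suc m) N (Q N m) (N ^ suc m) ⟩
    N * (N ^ suc m + suc m * Q N m) ∎
    where
    open ≡-Reasoning
    eq′ = trans (sym (+-suc y m)) eq
    ring₁ : ∀ y m Q Z Z₂ p → y * (m * (Z + Q)) + m * (Z₂ + 2 * Z + Q) + p ≡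
            m * (suc y * Z + Z₂ + (suc y * Q + Z)) + p
    ring₁ = solve-∀
    ring₂ : ∀ m N Q p → m * (N * Q) + N * p ≡ N * (p + m * Q)
    ring₂ = solve-∀

  y²*Z : ∀ m y N → y + m ≡ N → y * (y * Z N m) + (y * Z₂ N m + N * Z N m) ≡ m * (N * N ^ m)
  y²*Z m y N eq = +-cancelʳ-≡ (y * (N * N ^ m)) _ _ (begin
    y * (y * Z N m) + (y * Z₂ N m + N * Z N m) + y * (N * N ^ m)
      ≡⟨ ring₁ y N (Z N m) (Z₂ N m) (N * N ^ m) ⟩
    y * (y * Z N m + Z₂ N m + N * N ^ m) + N * Z N m
      ≡⟨ cong (λ s → y * s + N * Z N m) (y*Z+Z₂ m y N eq) ⟩
    y * (N * Q N m) + N * Z N m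
      ≡⟨ ring₂ y N (Q N m) (Z N m) ⟩
    N * (y * Q N m + Z N m)
      ≡⟨ cong₂ _*_ (trans (sym eq) (+-comm y m)) (y*Q+Z m y N eq) ⟩
    (m + y) * (N * N ^ m)
      ≡⟨ *-distribʳ-+ (N * N ^ m) m y ⟩
    m * (N * N ^ m) + y * (N * N ^ m) ∎)
    where
    open ≡-Reasoning
    ring₁ : ∀ y N Z Z₂ p → y * (y * Z) + (y * Z₂ + N * Z) + y * p ≡ y * (y * Z + Z₂ + p) + N * Z
    ring₁ = solve-∀
    ring₂ : ∀ y N Q Z → y * (N * Q) + N * Z ≡ N * (y * Q + Z)
    ring₂ = solve-∀

  y²*Z≤ : ∀ m y N → y + m ≡ N → y * (y * Z N m) ≤ m * (N * N ^ m)
  y²*Z≤ m y N eq = ≤-trans (m≤m+n _ _) (≤-reflexive (y²*Z m y N eq))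

  -- A crude bound suffices, since `Z₂` enters only the error of `y² Z`. The factors `y` are
  -- enlarged to `y + 1` to meet the induction hypothesis, and the constant 2 leaves room for the
  -- resulting `2 N m + 2 y m + y²`, which is at most `2 N²`.
  y³*Z₂≤ : ∀ m y N → y + m ≡ N → y * (y * (y * Z₂ N m)) ≤ 2 * (N * (m * (N * N ^ m)))
  y³*Z₂≤ zero    y N eq = ≤-trans (≤-reflexive (ring y)) z≤n
    where
    ring : ∀ y → y * (y * (y * 0)) ≡ 0
    ring = solve-∀
  y³*Z₂≤ (suc m) y N eq = begin
    y * (y * (y * (suc m * (Z₂ N m + 2 * Z N m + Q N m))))
      ≡⟨ ring₁ y (suc m) (Z₂ N m) (Z N m) (Q N m) ⟩
    suc m * (y * (y * (y * Z₂ N m)) + 2 * y * (y * (y * Z N m)) + y * y * (y * Q N m))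
      ≤⟨ *-monoʳ-≤ (suc m) (+-mono-≤ (+-mono-≤
           (≤-trans (*-mono-≤ y≤ (*-mono-≤ y≤ (*-mono-≤ y≤ (≤-refl {Z₂ N m})))) (y³*Z₂≤ m (suc y) N eq′))
           (*-monoʳ-≤ (2 * y) (≤-trans (*-mono-≤ y≤ (*-mono-≤ y≤ (≤-refl {Z N m}))) (y²*Z≤ m (suc y) N eq′))))
           (*-monoʳ-≤ (y * y) (≤-trans (*-mono-≤ y≤ (≤-refl {Q N m}))
             (≤-trans (m≤m+n _ (Z N m)) (≤-reflexive (y*Q+Z m (suc y) N eq′)))))) ⟩
    suc m * (2 * (N * (m * (N * N ^ m))) + 2 * y * (m * (N * N ^ m)) + y * y * (N * N ^ m))
      ≡⟨ ring₂ y (suc m) m N (N * N ^ m) ⟩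
    suc m * ((2 * N * m + 2 * y * m + y * y) * (N * N ^ m))
      ≤⟨ *-monoʳ-≤ (suc m) (*-monoˡ-≤ (N * N ^ m) quadratic) ⟩
    suc m * ((2 * N * N) * (N * N ^ m))
      ≡⟨ ring₃ (suc m) N (N * N ^ m) ⟩
    2 * (N * (suc m * (N * (N * N ^ m)))) ∎
    where
    open ≤-Reasoning
    eq′ = trans (sym (+-suc y m)) eq
    y≤ : y ≤ suc y
    y≤ = n≤1+n y
    ring₁ : ∀ y m Z₂ Z Q → y * (y * (y * (m * (Z₂ + 2 * Z + Q)))) ≡
            m * (y * (y * (y * Z₂)) + 2 * y * (y * (y * Z)) + y * y * (y * Q))
    ring₁ = solve-∀
    ring₂ : ∀ y m′ m N p → m′ * (2 * (N * (m * p)) + 2 * y * (m * p) + y * y * p) ≡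
            m′ * ((2 * N * m + 2 * y * m + y * y) * p)
    ring₂ = solve-∀
    ring₃ : ∀ m N p → m * ((2 * N * N) * p) ≡ 2 * (N * (m * (N * p)))
    ring₃ = solve-∀
    quadratic : 2 * N * m + 2 * y * m + y * y ≤ 2 * N * N
    quadratic rewrite sym eq = ≤-trans (m≤m+n _ (y * y + 2 * (y + m + 1) + 2 * y)) (≤-reflexive (ring y m))
      where
      ring : ∀ y m → 2 * (y + suc m) * m + 2 * y * m + y * y + (y * y + 2 * (y + m + 1) + 2 * y) ≡ 2 * (y + suc m) * (y + suc m)
      ring = solve-∀

  -- X is at least (1 − a/y) W, with both sides moved so that no subtraction occurs.
  Close : (y a X W : ℕ) → Set
  Close y a X W = y * W ≤ y * X + a * W

  -- Relative errors add: the second one arrives scaled by `X`, and `X ≤ W` bounds it.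
  close-* : ∀ y a b {X X′ W W′} → Close y a X W → X ≤ W → Close y b X′ W′ → Close y (a + b) (X * X′) (W * W′)
  close-* y a b {X} {X′} {W} {W′} p X≤W p′ = begin
    y * (W * W′)                           ≡⟨ *-assoc y W W′ ⟨
    y * W * W′                             ≤⟨ *-monoˡ-≤ W′ p ⟩
    (y * X + a * W) * W′                   ≡⟨ ring₁ y X a W W′ ⟩
    X * (y * W′) + a * (W * W′)            ≤⟨ +-monoˡ-≤ (a * (W * W′)) (*-monoʳ-≤ X p′) ⟩
    X * (y * X′ + b * W′) + a * (W * W′)   ≡⟨ ring₂ y X X′ a b W W′ ⟩
    y * (X * X′) + (a * (W * W′) + b * (X * W′))
      ≤⟨ +-monoʳ-≤ (y * (X * X′)) (+-monoʳ-≤ (a * (W * W′)) (*-monoʳ-≤ b (*-monoˡ-≤ W′ X≤W))) ⟩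
    y * (X * X′) + (a * (W * W′) + b * (W * W′)) ≡⟨ cong (y * (X * X′) +_) (*-distribʳ-+ (W * W′) a b) ⟨
    y * (X * X′) + (a + b) * (W * W′) ∎
    where
    open ≤-Reasoning
    ring₁ : ∀ y X a W W′ → (y * X + a * W) * W′ ≡ X * (y * W′) + a * (W * W′)
    ring₁ = solve-∀
    ring₂ : ∀ y X X′ a b W W′ → X * (y * X′ + b * W′) + a * (W * W′) ≡ y * (X * X′) + (a * (W * W′) + b * (X * W′))
    ring₂ = solve-∀

  -- For `a ≤ y` the condition reads `(y - a) W ≤ y X`, which is monotone in `W`; for `y ≤ a` it
  -- always holds.
  close-≤ : ∀ y a {X W W′} → Close y a X W → W′ ≤ W → Close y a X W′
  close-≤ y a {X} {W} {W′} p W′≤W with ≤-total a y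
  ... | inj₂ y≤a = ≤-trans (*-monoˡ-≤ W′ y≤a) (m≤n+m (a * W′) (y * X))
  ... | inj₁ a≤y = begin
    y * W′                     ≡⟨ cong (_* W′) y≡ ⟨
    (y ∸ a + a) * W′           ≡⟨ *-distribʳ-+ W′ (y ∸ a) a ⟩
    (y ∸ a) * W′ + a * W′      ≤⟨ +-monoˡ-≤ (a * W′) (≤-trans (*-monoʳ-≤ (y ∸ a) W′≤W) (+-cancelʳ-≤ (a * W) _ _ p′)) ⟩
    y * X + a * W′             ∎
    where
    open ≤-Reasoning
    y≡ : y ∸ a + a ≡ y
    y≡ = m∸n+n≡m a≤y
    p′ : (y ∸ a) * W + a * W ≤ y * X + a * W
    p′ = subst (_≤ y * X + a * W) (trans (cong (_* W) (sym y≡)) (*-distribʳ-+ W (y ∸ a) a)) p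

  close-cancel : ∀ y a b .{{_ : NonZero b}} {X W} → Close y a (X * b) (W * b) → Close y a X W
  close-cancel y a b {X} {W} p = *-cancelʳ-≤ _ _ b (subst₂ _≤_ (sym (*-assoc y W b)) (ring y X a W b) p)
    where
    ring : ∀ y X a W b → y * (X * b) + a * (W * b) ≡ (y * X + a * W) * b
    ring = solve-∀

  -- By `y²*Z` the defect is `y Z₂ + N Z`, whose parts are at most `2 N A / y²` and `N A / y²`. With
  -- `N ≤ q y` they total at most `3 q A / y`.
  Z-close : ∀ m y N q .{{_ : NonZero y}} → y + m ≡ N → N ≤ q * y →
            Close y (3 * q) (y * (y * Z N m)) (m * (N * N ^ m))
  Z-close m y N q eq N≤qy = *-cancelˡ-≤ y (begin
    y * (y * A)                                              ≡⟨ cong (λ s → y * (y * s)) (y²*Z m y N eq) ⟨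
    y * (y * (y * (y * Z N m) + (y * Z₂ N m + N * Z N m)))   ≡⟨ ring₁ y N (Z N m) (Z₂ N m) ⟩
    y * (y * (y * (y * Z N m))) + (y * (y * (y * Z₂ N m)) + N * (y * (y * Z N m)))
      ≤⟨ +-monoʳ-≤ (y * (y * (y * (y * Z N m)))) (+-mono-≤ (y³*Z₂≤ m y N eq) (*-monoʳ-≤ N (y²*Z≤ m y N eq))) ⟩
    y * (y * (y * (y * Z N m))) + (2 * (N * A) + N * A)      ≡⟨ cong (y * (y * (y * (y * Z N m))) +_) (ring₂ N A) ⟩
    y * (y * (y * (y * Z N m))) + N * (3 * A)
      ≤⟨ +-monoʳ-≤ (y * (y * (y * (y * Z N m)))) (*-monoˡ-≤ (3 * A) N≤qy) ⟩
    y * (y * (y * (y * Z N m))) + q * y * (3 * A)            ≡⟨ ring₃ y q A (y * (y * Z N m)) ⟩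
    y * (y * (y * (y * Z N m)) + 3 * q * A)                  ∎)
    where
    open ≤-Reasoning
    A = m * (N * N ^ m)
    ring₁ : ∀ y N Z Z₂ → y * (y * (y * (y * Z) + (y * Z₂ + N * Z))) ≡
            y * (y * (y * (y * Z))) + (y * (y * (y * Z₂)) + N * (y * (y * Z)))
    ring₁ = solve-∀
    ring₂ : ∀ N A → 2 * (N * A) + N * A ≡ N * (3 * A)
    ring₂ = solve-∀
    ring₃ : ∀ y q A X → y * (y * X) + q * y * (3 * A) ≡ y * (y * X + 3 * q * A)
    ring₃ = solve-∀

  -- num/den is the ratio of the covariance to its limit, where r = n − m and
  -- z = r + 1 − j.
  num den : (m n r z : ℕ) → ℕ
  num m n r z = suc n * (Z (suc n) m * (z * (r * (r * r))))
  den m n r z = suc r * (suc r * (suc n ^ m * (m * (n * n))))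

  module Bounds (m n r z j q : ℕ) .{{_ : NonZero n}} (r+m≡n : r + m ≡ n) (z+j≡1+r : z + j ≡ suc r) (n≤qr : n ≤ q * r) where

    y = suc r
    N = suc n

    y+m≡N : y + m ≡ N
    y+m≡N = cong suc r+m≡n

    P = N ^ m
    -- `N A′` is `num` times `y²`, the extra `y²` being what makes `Z` comparable with a power of
    -- `N`. `A` replaces `y² Z`, `z` and `r` in `A′` by their upper bounds.
    A  = m * (N * P) * (y * (y * (y * y)))
    A′ = y * (y * Z N m) * (z * (r * (r * r)))

    z≤y : z ≤ y
    z≤y = m+n≤o⇒m≤o z (≤-reflexive z+j≡1+r)

    r≤y : r ≤ y
    r≤y = n≤1+n r

    num*y² : num m n r z * (y * y) ≡ N * A′
    num*y² = ring N y (Z N m) (z * (r * (r * r)))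
      where
      ring : ∀ N y Z w → N * (Z * w) * (y * y) ≡ N * (y * (y * Z) * w)
      ring = solve-∀

    A′≤A : A′ ≤ A
    A′≤A = *-mono-≤ (y²*Z≤ m y N y+m≡N) (*-mono-≤ z≤y (*-mono-≤ r≤y (*-mono-≤ r≤y r≤y)))

    upper : n * num m n r z ≤ n * den m n r z + 3 * den m n r z
    upper = *-cancelʳ-≤ _ _ (y * y) (begin
      n * num m n r z * (y * y)              ≡⟨ *-assoc n _ (y * y) ⟩
      n * (num m n r z * (y * y))            ≡⟨ cong (n *_) num*y² ⟩
      n * (N * A′)                           ≤⟨ *-monoʳ-≤ n (*-monoʳ-≤ N A′≤A) ⟩
      n * (N * A)                            ≡⟨ ring₁ n N m P y ⟩
      N * N * (n * (m * P * (y * (y * (y * y)))))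
        ≤⟨ *-monoˡ-≤ (n * (m * P * (y * (y * (y * y))))) (square n) ⟩
      (n * n + 3 * n) * (n * (m * P * (y * (y * (y * y))))) ≡⟨ ring₂ n m P y ⟩
      (n * (y * (y * (P * (m * (n * n))))) + 3 * (y * (y * (P * (m * (n * n)))))) * (y * y) ∎)
      where
      open ≤-Reasoning
      -- `N A` contains `N²` where `den` contains `n²`; this ratio is the whole upper error `3 / n`.
      square : ∀ n .{{_ : NonZero n}} → suc n * suc n ≤ n * n + 3 * n
      square (suc n) = ≤-trans (m≤m+n _ n) (≤-reflexive (ring n))
        where
        ring : ∀ n → suc (suc n) * suc (suc n) + n ≡ suc n * suc n + 3 * suc n
        ring = solve-∀
      ring₁ : ∀ n N m P y → n * (N * (m * (N * P) * (y * (y * (y * y))))) ≡ N * N * (n * (m * P * (y * (y * (y * y)))))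
      ring₁ = solve-∀
      ring₂ : ∀ n m P y → (n * n + 3 * n) * (n * (m * P * (y * (y * (y * y))))) ≡
        (n * (y * (y * (P * (m * (n * n))))) + 3 * (y * (y * (P * (m * (n * n)))))) * (y * y)
      ring₂ = solve-∀

    -- `3 q` comes from `y² Z`, `j` from `z = y - j`, and 1 from each of the three factors
    -- `r = y - 1`.
    κ = 3 * q + (j + (1 + (1 + 1)))

    N≤qy : N ≤ q * y
    N≤qy = ≤-trans (+-mono-≤ (1≤q q n≤qr) n≤qr) (≤-reflexive (sym (*-suc q r)))
      where
      1≤q : ∀ q → n ≤ q * r → 1 ≤ q
      1≤q zero    n≤0 = ≤-trans (>-nonZero⁻¹ n) n≤0
      1≤q (suc q) _   = s≤s z≤n

    close-r : Close y 1 r y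
    close-r = ≤-reflexive (ring r)
      where
      ring : ∀ r → suc r * suc r ≡ suc r * r + 1 * suc r
      ring = solve-∀

    close-z : Close y j z y
    close-z = ≤-reflexive (trans (cong (y *_) (sym z+j≡1+r)) (trans (*-distribˡ-+ y z j) (cong (y * z +_) (*-comm y j))))

    close-A : Close y κ A′ A
    close-A = close-* y (3 * q) (j + (1 + (1 + 1))) (Z-close m y N q y+m≡N N≤qy) (y²*Z≤ m y N y+m≡N)
      (close-* y j (1 + (1 + 1)) {z} {r * (r * r)} {y} {y * (y * y)} close-z z≤y
        (close-* y 1 (1 + 1) {r} {r * r} {y} {y * y} close-r r≤y (close-* y 1 1 {r} {r} {y} {y} close-r r≤y close-r)))

    close-num-den : Close y κ (num m n r z) (den m n r z)
    close-num-den = close-cancel y κ (y * y) (close-≤ y κ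
      (subst (λ X → Close y κ X (N * A)) (sym num*y²)
        (close-* y 0 κ {N} {A′} {N} {A} (m≤m+n _ _) ≤-refl close-A))
      (begin
        y * (y * (P * (m * (n * n)))) * (y * y)    ≡⟨ ring₁ y P m n ⟩
        n * n * (m * P * (y * (y * (y * y))))      ≤⟨ *-monoˡ-≤ (m * P * (y * (y * (y * y)))) (*-mono-≤ (n≤1+n n) (n≤1+n n)) ⟩
        N * N * (m * P * (y * (y * (y * y))))      ≡⟨ ring₂ N y P m ⟩
        N * (m * (N * P) * (y * (y * (y * y))))    ∎))
      where
      open ≤-Reasoning
      ring₁ : ∀ y P m n → y * (y * (P * (m * (n * n)))) * (y * y) ≡ n * n * (m * P * (y * (y * (y * y))))
      ring₁ = solve-∀
      ring₂ : ∀ N y P m → N * N * (m * P * (y * (y * (y * y)))) ≡ N * (m * (N * P) * (y * (y * (y * y))))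
      ring₂ = solve-∀

    -- An error `κ / y` is at most `q κ / n`, because `n ≤ q y`.
    lower : n * den m n r z ≤ n * num m n r z + q * κ * den m n r z
    lower = close-scale (num m n r z) (den m n r z) close-num-den
      where
      close-scale : ∀ X W → Close y κ X W → n * W ≤ n * X + q * κ * W
      close-scale X W p with ≤-total W X
      ... | inj₁ W≤X = ≤-trans (*-monoʳ-≤ n W≤X) (m≤m+n _ _)
      ... | inj₂ X≤W = begin
        n * W                     ≡⟨ cong (n *_) (m+[n∸m]≡n X≤W) ⟨
        n * (X + (W ∸ X))         ≡⟨ *-distribˡ-+ n X (W ∸ X) ⟩
        n * X + n * (W ∸ X)       ≤⟨ +-monoʳ-≤ (n * X) (*-monoˡ-≤ (W ∸ X) (≤-trans (n≤1+n n) N≤qy)) ⟩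
        n * X + q * y * (W ∸ X)   ≡⟨ cong (n * X +_) (*-assoc q y (W ∸ X)) ⟩
        n * X + q * (y * (W ∸ X)) ≤⟨ +-monoʳ-≤ (n * X) (*-monoʳ-≤ q (+-cancelˡ-≤ (y * X) _ _ p′)) ⟩
        n * X + q * (κ * W)       ≡⟨ cong (n * X +_) (*-assoc q κ W) ⟨
        n * X + q * κ * W         ∎
        where
        open ≤-Reasoning
        p′ : y * X + y * (W ∸ X) ≤ y * X + κ * W
        p′ = subst (_≤ y * X + κ * W) (trans (cong (y *_) (sym (m+[n∸m]≡n X≤W))) (*-distribˡ-+ y X (W ∸ X))) p

open ContentSums
open Parking
open Estimates
open import Data.Integer as ℤ using (+_)
import Data.Integer.Properties as ℤ
open import Data.Rational using (ℚ; mkℚ; 0ℚ; 1ℚ; _/_; _+_; _-_; _*_; -_; 1/_; _÷_; _≤_; _<_; ∣_∣; *≤*; *<*; NonZero; Positive; NonNegative; positive; nonNegative)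
open import Data.Rational.Properties
open import Data.Rational.Solver using (module +-*-Solver)
open +-*-Solver using (solve; _:+_; _:*_; _:-_; :-_; con; _:=_)

private
  variable
    A : Set

-- Transfer to the rationals: embedding of ℕ, means and covariances.

fromℕ-mkℚ : ∀ a → fromℕ a ≡ mkℚ (+ a) 0 (Coprimality.sym (Coprimality.1-coprimeTo a))
fromℕ-mkℚ a = ↥p/↧p≡p (mkℚ (+ a) 0 _)

fromℕ-+ : ∀ a b → fromℕ (a ℕ.+ b) ≡ fromℕ a + fromℕ b
fromℕ-+ a b = sym (trans (cong₂ _+_ (fromℕ-mkℚ a) (fromℕ-mkℚ b))
  (cong (_/ 1) (cong₂ ℤ._+_ (ℤ.*-identityʳ (+ a)) (ℤ.*-identityʳ (+ b)))))

fromℕ-* : ∀ a b → fromℕ (a ℕ.* b) ≡ fromℕ a * fromℕ b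
fromℕ-* a b = sym (trans (cong₂ _*_ (fromℕ-mkℚ a) (fromℕ-mkℚ b)) (cong (_/ 1) (sym (ℤ.pos-* a b))))

fromℕ-mono-≤ : ∀ {a b} → a ℕ.≤ b → fromℕ a ≤ fromℕ b
fromℕ-mono-≤ {a} {b} a≤b = subst₂ _≤_ (sym (fromℕ-mkℚ a)) (sym (fromℕ-mkℚ b))
  (*≤* (subst₂ ℤ._≤_ (sym (ℤ.*-identityʳ (+ a))) (sym (ℤ.*-identityʳ (+ b))) (ℤ.+≤+ a≤b)))

fromℕ-cancel-≤ : ∀ {a b} → fromℕ a ≤ fromℕ b → a ℕ.≤ b
fromℕ-cancel-≤ {a} {b} p = ℤ.drop‿+≤+ (subst₂ ℤ._≤_ (ℤ.*-identityʳ (+ a)) (ℤ.*-identityʳ (+ b))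
  (drop-*≤* (subst₂ _≤_ (fromℕ-mkℚ a) (fromℕ-mkℚ b) p)))

fromℕ-nonNeg : ∀ a → NonNegative (fromℕ a)
fromℕ-nonNeg a = normalize-nonNeg a 1

fromℕ-pos : ∀ a .{{_ : ℕ.NonZero a}} → Positive (fromℕ a)
fromℕ-pos (suc a) = normalize-pos (suc a) 1

*-cancelˡ-≡ : ∀ p .{{_ : Positive p}} {x y} → p * x ≡ p * y → x ≡ y
*-cancelˡ-≡ p eq = ≤-antisym (*-cancelˡ-≤-pos p (≤-reflexive eq)) (*-cancelˡ-≤-pos p (≤-reflexive (sym eq)))

-- The denominator of `ε` serves as `d`, the numerator being at least 1.
archimedean : ∀ ε → 0ℚ < ε → ∃ λ d → 1ℚ ≤ fromℕ d * ε
archimedean ε@(mkℚ ℤ.+[1+ a ] d _) _ = suc d , subst (λ x → 1ℚ ≤ x * ε) (sym (fromℕ-mkℚ (suc d)))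
  (toℚᵘ-cancel-≤ (ℚᵘ.≤-respʳ-≃ (ℚᵘ.≃-sym (toℚᵘ-homo-* (mkℚ (+ suc d) 0 (Coprimality.sym (Coprimality.1-coprimeTo (suc d)))) ε))
    (ℚᵘ.*≤* (ℤ.+≤+ (ℕ.≤-trans (ℕ.m≤m+n _ (suc d ℕ.* a)) (ℕ.≤-reflexive (ring d a)))))))
  where
  ring : ∀ d a → 1 ℕ.* (1 ℕ.* suc d) ℕ.+ suc d ℕ.* a ≡ suc d ℕ.* suc a ℕ.* 1
  ring = solve-∀
archimedean (mkℚ (+ 0) _ _)       (*<* (ℤ.+<+ ()))
archimedean (mkℚ ℤ.-[1+ a ] _ _) (*<* ())

sum-fromℕ : ∀ (f : A → ℕ) xs → sum (List.map (fromℕ ∘ f) xs) ≡ fromℕ (total f xs)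
sum-fromℕ f []       = refl
sum-fromℕ f (x ∷ xs) = trans (cong (_+_ (fromℕ (f x))) (sum-fromℕ f xs)) (sym (fromℕ-+ (f x) (total f xs)))

length≡total : ∀ (xs : List A) → length xs ≡ total (λ _ → 1) xs
length≡total []       = refl
length≡total (x ∷ xs) = cong suc (length≡total xs)

length*mean : ∀ xs → fromℕ (length xs) * mean xs ≡ sum xs
length*mean []          = refl
length*mean (x ∷ xs) = begin
  C * (s * (+ 1 / suc l))    ≡⟨ solve 3 (λ C s u → C :* (s :* u) := s :* (C :* u)) refl C s (+ 1 / suc l) ⟩
  s * (C * (+ 1 / suc l))    ≡⟨ cong (s *_) (cong₂ _*_ (fromℕ-mkℚ (suc l)) (↥p/↧p≡p (1/ C′))) ⟩
  s * (C′ * 1/ C′)           ≡⟨ cong (s *_) (*-inverseʳ C′) ⟩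
  s * 1ℚ                     ≡⟨ *-identityʳ s ⟩
  s                          ∎
  where
  open ≡-Reasoning
  l = length xs
  s = sum (x ∷ xs)
  C = fromℕ (suc l)
  C′ = mkℚ (+ suc l) 0 (Coprimality.sym (Coprimality.1-coprimeTo (suc l)))

sum-centred : ∀ (X Y : A → ℚ) μ ν xs →
  sum (List.map (λ x → (X x - μ) * (Y x - ν)) xs) ≡
  sum (List.map (λ x → X x * Y x) xs) - μ * sum (List.map Y xs) - ν * sum (List.map X xs)
    + fromℕ (length xs) * (μ * ν)
sum-centred X Y μ ν []       =
  solve 2 (λ μ ν → con 0ℚ := con 0ℚ :- μ :* con 0ℚ :- ν :* con 0ℚ :+ con 0ℚ :* (μ :* ν)) refl μ ν
sum-centred X Y μ ν (x ∷ xs) rewrite sum-centred X Y μ ν xs | fromℕ-+ 1 (length xs) =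
  solve 8 (λ a b μ ν p q r l →
    (a :- μ) :* (b :- ν) :+ (p :- μ :* q :- ν :* r :+ l :* (μ :* ν)) :=
    (a :* b :+ p) :- μ :* (b :+ q) :- ν :* (a :+ r) :+ (con 1ℚ :+ l) :* (μ :* ν))
    refl (X x) (Y x) μ ν (sum (List.map (λ x → X x * Y x) xs)) (sum (List.map Y xs)) (sum (List.map X xs)) (fromℕ (length xs))

length²*covariance : ∀ (X Y : A → ℚ) xs →
  let C = fromℕ (length xs) ; μ = mean (List.map X xs) ; ν = mean (List.map Y xs) in
  C * (C * mean (List.map (λ x → (X x - μ) * (Y x - ν)) xs)) ≡
  C * sum (List.map (λ x → X x * Y x) xs) - sum (List.map X xs) * sum (List.map Y xs)
length²*covariance X Y xs = begin
  C * (C * mean (List.map (λ x → (X x - μ) * (Y x - ν)) xs))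
    ≡⟨ cong (C *_) (trans (total-mean (λ x → (X x - μ) * (Y x - ν))) (sum-centred X Y μ ν xs)) ⟩
  C * (sXY - μ * sY - ν * sX + C * (μ * ν))
    ≡⟨ solve 6 (λ C μ ν a b d → C :* (a :- μ :* b :- ν :* d :+ C :* (μ :* ν)) :=
         C :* a :- C :* μ :* b :- C :* ν :* d :+ C :* μ :* (C :* ν)) refl C μ ν sXY sY sX ⟩
  C * sXY - C * μ * sY - C * ν * sX + C * μ * (C * ν)
    ≡⟨ cong₂ (λ a b → C * sXY - a * sY - b * sX + a * b) (total-mean X) (total-mean Y) ⟩
  C * sXY - sX * sY - sY * sX + sX * sY
    ≡⟨ solve 3 (λ a b c → a :- b :* c :- c :* b :+ b :* c := a :- b :* c) refl (C * sXY) sX sY ⟩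
  C * sXY - sX * sY ∎
  where
  open ≡-Reasoning
  C = fromℕ (length xs)
  μ = mean (List.map X xs)
  ν = mean (List.map Y xs)
  sX = sum (List.map X xs)
  sY = sum (List.map Y xs)
  sXY = sum (List.map (λ x → X x * Y x) xs)
  total-mean : ∀ X → C * mean (List.map X xs) ≡ sum (List.map X xs)
  total-mean X = trans (cong (λ l → fromℕ l * mean (List.map X xs)) (sym (length-map X xs))) (length*mean (List.map X xs))

-- Exact moments on `PF m n` and the exact covariance.

module Counts (m n r : ℕ) (r+m≡n : r ℕ.+ m ≡ n) where

  N = suc n
  y = suc r

  y+m≡N : y ℕ.+ m ≡ N
  y+m≡N = cong suc r+m≡n

  m≤n : m ℕ.≤ n
  m≤n = ℕ.m+n≤o⇒n≤o r (ℕ.≤-reflexive r+m≡n)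

  n∸m≡r : n ℕ.∸ m ≡ r
  n∸m≡r = trans (cong (ℕ._∸ m) (sym r+m≡n)) (ℕ.m+n∸n≡m r m)

  -- The factor `N` avoids the exponent `m - 1` when `m = 0`. Multiplying `contentSum-ok` by
  -- `N = y + m` lets the term `m N^m` cancel.
  N*#PF : N ℕ.* length (PF m n) ≡ y ℕ.* N ℕ.^ m
  N*#PF = ℕ.+-cancelʳ-≡ (m ℕ.* N ℕ.^ m) _ _ (begin
    N ℕ.* length (PF m n) ℕ.+ m ℕ.* N ℕ.^ m    ≡⟨ cong₂ (λ a b → N ℕ.* a ℕ.+ b) #PF (sym (N*down m)) ⟩
    N ℕ.* C ℕ.+ N ℕ.* down (N ℕ.^_) m          ≡⟨ ℕ.*-distribˡ-+ N C _ ⟨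
    N ℕ.* (C ℕ.+ down (N ℕ.^_) m)              ≡⟨ cong₂ ℕ._*_ (sym y+m≡N) (contentSum-ok n m y y+m≡N) ⟩
    (y ℕ.+ m) ℕ.* N ℕ.^ m                      ≡⟨ ℕ.*-distribʳ-+ (N ℕ.^ m) y m ⟩
    y ℕ.* N ℕ.^ m ℕ.+ m ℕ.* N ℕ.^ m            ∎)
    where
    open ≡-Reasoning
    C = contentSum n m (ok y)
    #PF : length (PF m n) ≡ C
    #PF = trans (length≡total (PF m n)) (trans (total-PF m n y y+m≡N m≤n (λ _ → 1) (λ _ → 1) (λ _ _ → refl))
      (contentSum-cong n m λ cs → ℕ.*-identityʳ (ok y cs)))
    N*down : ∀ m → N ℕ.* down (N ℕ.^_) m ≡ m ℕ.* N ℕ.^ m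
    N*down zero    = ℕ.*-zeroʳ N
    N*down (suc m) = ring N (suc m) (N ℕ.^ m)
      where
      ring : ∀ N m p → N ℕ.* (m ℕ.* p) ≡ m ℕ.* (N ℕ.* p)
      ring = solve-∀

  total-k : ∀ i → 1 ℕ.≤ i → i ℕ.≤ r → total (k i) (PF m n) ≡ i ℕ.* N ℕ.^ m
  total-k (suc i) _ i<r = trans
    (total-PF m n y y+m≡N m≤n (k (suc i)) (hit (suc i))
      λ π parks → k≡hit i π parks (subst (i ℕ.<_) (sym n∸m≡r) i<r))
    (contentSum-hit n m y (suc i) (ℕ.s≤s i<r) y+m≡N)

  total-k*k : ∀ i j → 1 ℕ.≤ i → i ℕ.≤ j → j ℕ.≤ r →
              total (λ π → k i π ℕ.* k j π) (PF m n) ≡ i ℕ.* R N j m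
  total-k*k (suc i) (suc j) _ i≤j j<r = trans
    (total-PF m n y y+m≡N m≤n (λ π → k (suc i) π ℕ.* k (suc j) π) (λ cs → hit (suc i) cs ℕ.* hit (suc j) cs)
      λ π parks → cong₂ ℕ._*_ (k≡hit i π parks (subst (i ℕ.<_) (sym n∸m≡r) (ℕ.≤-trans i≤j j<r)))
                              (k≡hit j π parks (subst (j ℕ.<_) (sym n∸m≡r) j<r)))
    (contentSum-hit-hit n m y (suc i) (suc j) i≤j (ℕ.s≤s j<r) y+m≡N)

-- After multiplication by `N²`, one `N P` in the product of the means is traded for `y Q + Z`; the
-- cancellation of `Q` is then a ring identity in `z + j`.
scaled-covariance : ∀ {N C V P Q Z i j y z} .{{_ : Positive P}} →
  N * C ≡ y * P → C * (C * V) ≡ C * (i * (j * Q + Z)) - (i * P) * (j * P) →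
  y * Q + Z ≡ N * P → z + j ≡ y →
  y * (y * P) * V ≡ i * (N * (Z * z))
scaled-covariance {N} {C} {V} {P} {Q} {Z} {i} {j} {y} {z} NC≡yP CCV≡ yQ+Z≡NP refl = *-cancelˡ-≡ P (begin
  P * (y * (y * P) * V)
    ≡⟨ solve 3 (λ P y V → P :* (y :* (y :* P) :* V) := (y :* P) :* (y :* P) :* V) refl P y V ⟩
  (y * P) * (y * P) * V
    ≡⟨ cong (λ a → a * a * V) (sym NC≡yP) ⟩
  (N * C) * (N * C) * V
    ≡⟨ solve 3 (λ N C V → (N :* C) :* (N :* C) :* V := N :* N :* (C :* (C :* V))) refl N C V ⟩
  N * N * (C * (C * V))
    ≡⟨ cong (N * N *_) CCV≡ ⟩
  N * N * (C * (i * (j * Q + Z)) - (i * P) * (j * P))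
    ≡⟨ solve 7 (λ N C i j Q Z P → N :* N :* (C :* (i :* (j :* Q :+ Z)) :- (i :* P) :* (j :* P)) :=
         N :* (N :* C) :* (i :* (j :* Q :+ Z)) :- N :* i :* j :* P :* (N :* P)) refl N C i j Q Z P ⟩
  N * (N * C) * (i * (j * Q + Z)) - N * i * j * P * (N * P)
    ≡⟨ cong₂ (λ a b → N * a * (i * (j * Q + Z)) - N * i * j * P * b) NC≡yP (sym yQ+Z≡NP) ⟩
  N * (y * P) * (i * (j * Q + Z)) - N * i * j * P * (y * Q + Z)
    ≡⟨ solve 7 (λ N i j Q Z P z →
         N :* ((z :+ j) :* P) :* (i :* (j :* Q :+ Z)) :- N :* i :* j :* P :* ((z :+ j) :* Q :+ Z) :=
         P :* (i :* (N :* (Z :* z)))) refl N i j Q Z P z ⟩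
  P * (i * (N * (Z * z))) ∎)
  where open ≡-Reasoning

-- With `c = m / n` and `1 - c = r / n` the limit is `i m n² / r³`, which is where `m n²` in `den`
-- and `r³` in `num` come from.
scaled-ratio : ∀ {g L V c N P Z i y z m n r} .{{_ : Positive i}} →
  g * L ≡ V → L * cube (1ℚ - c) ≡ i * c → m ≡ c * n → r ≡ (1ℚ - c) * n →
  y * (y * P) * V ≡ i * (N * (Z * z)) →
  g * (y * (y * (P * (m * (n * n))))) ≡ N * (Z * (z * (r * (r * r))))
scaled-ratio {g} {L} {V} {c} {N} {P} {Z} {i} {y} {z} {m} {n} {r} gL≡V L≡ refl refl cov = *-cancelˡ-≡ i (begin
  i * (g * (y * (y * (P * (c * n * (n * n))))))
    ≡⟨ solve 6 (λ i g y P c n → i :* (g :* (y :* (y :* (P :* (c :* n :* (n :* n)))))) :=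
         y :* (y :* P) :* g :* (i :* c) :* (n :* (n :* n))) refl i g y P c n ⟩
  y * (y * P) * g * (i * c) * (n * (n * n))
    ≡⟨ cong (λ a → y * (y * P) * g * a * (n * (n * n))) (sym L≡) ⟩
  y * (y * P) * g * (L * (d * d * d)) * (n * (n * n))
    ≡⟨ solve 6 (λ y P g L d n → y :* (y :* P) :* g :* (L :* (d :* d :* d)) :* (n :* (n :* n)) :=
         y :* (y :* P) :* (g :* L) :* (d :* n :* (d :* n :* (d :* n)))) refl y P g L d n ⟩
  y * (y * P) * (g * L) * (d * n * (d * n * (d * n)))
    ≡⟨ cong (_* (d * n * (d * n * (d * n)))) (trans (cong (y * (y * P) *_) gL≡V) cov) ⟩
  i * (N * (Z * z)) * (d * n * (d * n * (d * n)))
    ≡⟨ solve 5 (λ i N Z z s → i :* (N :* (Z :* z)) :* s := i :* (N :* (Z :* (z :* s)))) refl i N Z z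
         (d * n * (d * n * (d * n))) ⟩
  i * (N * (Z * (z * (d * n * (d * n * (d * n)))))) ∎)
  where
  open ≡-Reasoning
  d = 1ℚ - c

-- Divided by `n b`, the two inequalities bound `g - 1` from both sides by `K / n`, which is below
-- `ε`.
near-one : ∀ {g ε K} n a b .{{_ : ℕ.NonZero b}} → g * fromℕ b ≡ fromℕ a →
  n ℕ.* a ℕ.≤ n ℕ.* b ℕ.+ K ℕ.* b → n ℕ.* b ℕ.≤ n ℕ.* a ℕ.+ K ℕ.* b →
  fromℕ K < fromℕ n * ε → ∣ g - 1ℚ ∣ < ε
near-one {g} {ε} {K} n a b gb≡a na≤ nb≤ K<nε = bound (∣p∣≡p∨∣p∣≡-p (g - 1ℚ))
  where
  F = fromℕ
  instance
    _ = fromℕ-pos b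
    _ = fromℕ-nonNeg n
  na≡ : F (n ℕ.* a) ≡ F n * g * F b
  na≡ = trans (fromℕ-* n a) (trans (cong (F n *_) (sym gb≡a)) (sym (*-assoc (F n) g (F b))))
  ng≤n+K : F n * g ≤ F n + F K
  ng≤n+K = *-cancelʳ-≤-pos (F b) (subst₂ _≤_ na≡
    (trans (cong F (sym (ℕ.*-distribʳ-+ b n K))) (trans (fromℕ-* (n ℕ.+ K) b) (cong (_* F b) (fromℕ-+ n K))))
    (fromℕ-mono-≤ na≤))
  n≤ng+K : F n ≤ F n * g + F K
  n≤ng+K = *-cancelʳ-≤-pos (F b) (subst₂ _≤_ (fromℕ-* n b)
    (trans (fromℕ-+ (n ℕ.* a) (K ℕ.* b)) (trans (cong₂ _+_ na≡ (fromℕ-* K b)) (sym (*-distribʳ-+ (F b) (F n * g) (F K)))))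
    (fromℕ-mono-≤ nb≤))
  n*[g-1]≤K : F n * (g - 1ℚ) ≤ F K
  n*[g-1]≤K = subst₂ _≤_
    (solve 2 (λ n g → n :* g :+ :- n := n :* (g :- con 1ℚ)) refl (F n) g)
    (solve 2 (λ n K → n :+ K :+ :- n := K) refl (F n) (F K))
    (+-monoˡ-≤ (- F n) ng≤n+K)
  n*[1-g]≤K : F n * (- (g - 1ℚ)) ≤ F K
  n*[1-g]≤K = subst₂ _≤_
    (solve 2 (λ n g → n :+ :- (n :* g) := n :* (:- (g :- con 1ℚ))) refl (F n) g)
    (solve 2 (λ n K → n :+ K :+ :- n := K) refl (F n * g) (F K))
    (+-monoˡ-≤ (- (F n * g)) n≤ng+K)
  below : ∀ {x} → F n * x ≤ F K → x < ε
  below nx≤K = *-cancelˡ-<-nonNeg (F n) (≤-<-trans nx≤K K<nε)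
  bound : _ → ∣ g - 1ℚ ∣ < ε
  bound (inj₁ eq) = subst (_< ε) (sym eq) (below n*[g-1]≤K)
  bound (inj₂ eq) = subst (_< ε) (sym eq) (below n*[1-g]≤K)

÷-* : ∀ x y .{{_ : NonZero y}} → x ÷ y * y ≡ x
÷-* x y = trans (*-assoc x (1/ y) y) (trans (cong (x *_) (*-inverseˡ y)) (*-identityʳ x))

module _ (m n r i j z : ℕ) (1≤i : 1 ℕ.≤ i) (i≤j : i ℕ.≤ j) (j≤r : j ℕ.≤ r)
         (r+m≡n : r ℕ.+ m ≡ n) (z+j≡1+r : z ℕ.+ j ≡ suc r) where

  open Counts m n r r+m≡n

  private
    F = fromℕ
    P = N ℕ.^ m

  sum-k : ∀ i → 1 ℕ.≤ i → i ℕ.≤ r → sum (List.map (kℚ m n i) (PF m n)) ≡ F i * F P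
  sum-k i 1≤i i≤r = trans (sum-fromℕ (k i) (PF m n)) (trans (cong F (total-k i 1≤i i≤r)) (fromℕ-* i P))

  sum-k*k : sum (List.map (λ π → kℚ m n i π * kℚ m n j π) (PF m n)) ≡ F i * (F j * F (Q N m) + F (Z N m))
  sum-k*k = begin
    sum (List.map (λ π → kℚ m n i π * kℚ m n j π) (PF m n))
      ≡⟨ cong sum (map-cong (λ π → sym (fromℕ-* (k i π) (k j π))) (PF m n)) ⟩
    sum (List.map (λ π → F (k i π ℕ.* k j π)) (PF m n))
      ≡⟨ sum-fromℕ (λ π → k i π ℕ.* k j π) (PF m n) ⟩
    F (total (λ π → k i π ℕ.* k j π) (PF m n))
      ≡⟨ cong F (total-k*k i j 1≤i i≤j j≤r) ⟩
    F (i ℕ.* (j ℕ.* Q N m ℕ.+ Z N m))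
      ≡⟨ trans (fromℕ-* i _) (cong (F i *_) (trans (fromℕ-+ (j ℕ.* Q N m) (Z N m)) (cong (_+ F (Z N m)) (fromℕ-* j (Q N m))))) ⟩
    F i * (F j * F (Q N m) + F (Z N m)) ∎
    where open ≡-Reasoning

  Cov-k : F y * (F y * F P) * Cov (kℚ m n i) (kℚ m n j) ≡ F i * (F N * (F (Z N m) * F z))
  Cov-k = scaled-covariance {F N} {F (length (PF m n))} {Cov (kℚ m n i) (kℚ m n j)} {F P} {F (Q N m)} {F (Z N m)} {F i} {F j} {F y} {F z}
    (trans (sym (fromℕ-* N (length (PF m n)))) (trans (cong F N*#PF) (fromℕ-* y P)))
    (trans (length²*covariance (kℚ m n i) (kℚ m n j) (PF m n))
      (cong₂ _-_ (cong (F (length (PF m n)) *_) sum-k*k)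
                 (cong₂ _*_ (sum-k i 1≤i (ℕ.≤-trans i≤j j≤r)) (sum-k j (ℕ.≤-trans 1≤i i≤j) j≤r))))
    (trans (cong (_+ F (Z N m)) (sym (fromℕ-* y (Q N m)))) (trans (sym (fromℕ-+ (y ℕ.* Q N m) (Z N m)))
      (trans (cong F (y*Q+Z m y N y+m≡N)) (fromℕ-* N P))))
    (trans (sym (fromℕ-+ z j)) (cong F z+j≡1+r))
    where instance _ = fromℕ-pos P {{ℕ.m^n≢0 N m}}

archimedean-bound : ∀ {ε} K d n → 0ℚ < ε → 1ℚ ≤ fromℕ d * ε → K ℕ.* d ℕ.< n → fromℕ K < fromℕ n * ε
archimedean-bound {ε} K d n 0<ε 1≤dε Kd<n = begin-strict
  fromℕ K                       ≡⟨ *-identityʳ (fromℕ K) ⟨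
  fromℕ K * 1ℚ                  ≤⟨ *-monoˡ-≤-nonNeg (fromℕ K) {{fromℕ-nonNeg K}} 1≤dε ⟩
  fromℕ K * (fromℕ d * ε)       ≡⟨ *-assoc (fromℕ K) (fromℕ d) ε ⟨
  fromℕ K * fromℕ d * ε         ≡⟨ cong (_* ε) (fromℕ-* K d) ⟨
  fromℕ (K ℕ.* d) * ε           ≡⟨ +-identityˡ (fromℕ (K ℕ.* d) * ε) ⟨
  0ℚ + fromℕ (K ℕ.* d) * ε      <⟨ +-monoˡ-< (fromℕ (K ℕ.* d) * ε) 0<ε ⟩
  ε + fromℕ (K ℕ.* d) * ε       ≡⟨ solve 2 (λ ε a → ε :+ a :* ε := (con 1ℚ :+ a) :* ε) refl ε (fromℕ (K ℕ.* d)) ⟩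
  (1ℚ + fromℕ (K ℕ.* d)) * ε    ≡⟨ cong (_* ε) (fromℕ-+ 1 (K ℕ.* d)) ⟨
  fromℕ (1 ℕ.+ K ℕ.* d) * ε     ≤⟨ *-monoʳ-≤-nonNeg ε {{nonNegative (<⇒≤ 0<ε)}} (fromℕ-mono-≤ Kd<n) ⟩
  fromℕ n * ε                   ∎
  where open ≤-Reasoning

fromℕ-den : ∀ m n r z → fromℕ (den m n r z) ≡
  fromℕ (suc r) * (fromℕ (suc r) * (fromℕ (suc n ℕ.^ m) * (fromℕ m * (fromℕ n * fromℕ n))))
fromℕ-den m n r z =
  trans (fromℕ-* (suc r) (suc r ℕ.* (suc n ℕ.^ m ℕ.* (m ℕ.* (n ℕ.* n))))) (cong (fromℕ (suc r) *_)
  (trans (fromℕ-* (suc r) (suc n ℕ.^ m ℕ.* (m ℕ.* (n ℕ.* n)))) (cong (fromℕ (suc r) *_)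
  (trans (fromℕ-* (suc n ℕ.^ m) (m ℕ.* (n ℕ.* n))) (cong (fromℕ (suc n ℕ.^ m) *_)
  (trans (fromℕ-* m (n ℕ.* n)) (cong (fromℕ m *_) (fromℕ-* n n))))))))

fromℕ-num : ∀ m n r z → fromℕ (num m n r z) ≡
  fromℕ (suc n) * (fromℕ (Z (suc n) m) * (fromℕ z * (fromℕ r * (fromℕ r * fromℕ r))))
fromℕ-num m n r z =
  trans (fromℕ-* (suc n) (Z (suc n) m ℕ.* (z ℕ.* (r ℕ.* (r ℕ.* r))))) (cong (fromℕ (suc n) *_)
  (trans (fromℕ-* (Z (suc n) m) (z ℕ.* (r ℕ.* (r ℕ.* r)))) (cong (fromℕ (Z (suc n) m) *_)
  (trans (fromℕ-* z (r ℕ.* (r ℕ.* r))) (cong (fromℕ z *_)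
  (trans (fromℕ-* r (r ℕ.* r)) (cong (fromℕ r *_) (fromℕ-* r r))))))))

Cov-ratio : ∀ m n r i j z c L .{{_ : NonZero L}} → 1 ℕ.≤ i → i ℕ.≤ j → j ℕ.≤ r → r ℕ.+ m ≡ n → z ℕ.+ j ≡ suc r →
  L * cube (1ℚ - c) ≡ fromℕ i * c → fromℕ m ≡ c * fromℕ n → fromℕ r ≡ (1ℚ - c) * fromℕ n →
  Cov (kℚ m n i) (kℚ m n j) ÷ L * fromℕ (den m n r z) ≡ fromℕ (num m n r z)
Cov-ratio m n r i j z c L 1≤i i≤j j≤r r+m≡n z+j≡1+r L≡ m≡cn r≡[1-c]n =
  trans (cong (V ÷ L *_) (fromℕ-den m n r z)) (trans
    (scaled-ratio {V ÷ L} {L} {V} {c} {fromℕ (suc n)} {fromℕ (suc n ℕ.^ m)} {fromℕ (Z (suc n) m)} {fromℕ i}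
      {fromℕ (suc r)} {fromℕ z} {fromℕ m} {fromℕ n} {fromℕ r} {{fromℕ-pos i {{ℕ.>-nonZero 1≤i}}}}
      (÷-* V L) L≡ m≡cn r≡[1-c]n (Cov-k m n r i j z 1≤i i≤j j≤r r+m≡n z+j≡1+r))
    (sym (fromℕ-num m n r z)))
  where V = Cov (kℚ m n i) (kℚ m n j)

-- Bounds n times the relative error of num against den, if 1/(1 − c) ≤ q.
errorConstant : ℕ → ℕ → ℕ
errorConstant q j = 3 ℕ.+ q ℕ.* (3 ℕ.* q ℕ.+ (j ℕ.+ (1 ℕ.+ (1 ℕ.+ 1))))

Cov-near-limit : ∀ m n i j q c L ε .{{_ : NonZero L}} → 1 ℕ.≤ i → i ℕ.≤ j → j ℕ.≤ n ℕ.∸ m → 1 ℕ.≤ n →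
  0ℚ < c → c < 1ℚ → 1ℚ ≤ fromℕ q * (1ℚ - c) → L * cube (1ℚ - c) ≡ fromℕ i * c → fromℕ m ≡ c * fromℕ n →
  fromℕ (errorConstant q j) < fromℕ n * ε → ∣ Cov (kℚ m n i) (kℚ m n j) ÷ L - 1ℚ ∣ < ε
Cov-near-limit m n i j q c L ε 1≤i i≤j j≤r 1≤n 0<c c<1 1≤q[1-c] L≡ m≡cn K<nε =
  near-one {V ÷ L} {ε} {K} n (num m n r z) (den m n r z) {{den≢0}}
    (Cov-ratio m n r i j z c L 1≤i i≤j j≤r r+m≡n z+j≡1+r L≡ m≡cn r≡[1-c]n) upper′ lower′ K<nε
  where
  V = Cov (kℚ m n i) (kℚ m n j)
  K = errorConstant q j
  -- Neither this subtraction nor the next truncates: `c < 1` gives `m ≤ n`, and `j ≤ r` is assumed.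
  r = n ℕ.∸ m
  z = suc r ℕ.∸ j
  instance
    n≢0 : ℕ.NonZero n
    n≢0 = ℕ.>-nonZero 1≤n
    n-nonNeg : NonNegative (fromℕ n)
    n-nonNeg = fromℕ-nonNeg n
  -- `den` has the factor `m`, so `0 < c` and `1 ≤ n` are what make it nonzero.
  m-pos : Positive (fromℕ m)
  m-pos = subst Positive (sym m≡cn) (pos*pos⇒pos c {{positive 0<c}} (fromℕ n) {{fromℕ-pos n}})
  m≢0 : ℕ.NonZero m
  m≢0 = ℕ.≢-nonZero λ m≡0 → <-irrefl (cong fromℕ (sym m≡0)) (positive⁻¹ (fromℕ m) {{m-pos}})
  den≢0 : ℕ.NonZero (den m n r z)
  den≢0 = ℕ.m*n≢0 (suc r) _ {{_}} {{ℕ.m*n≢0 (suc r) _ {{_}} {{ℕ.m*n≢0 (suc n ℕ.^ m) _ {{ℕ.m^n≢0 (suc n) m}}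
    {{ℕ.m*n≢0 m _ {{m≢0}} {{ℕ.m*n≢0 n n}}}}}}}}
  m≤n : m ℕ.≤ n
  m≤n = fromℕ-cancel-≤ (subst₂ _≤_ (sym m≡cn) (*-identityˡ (fromℕ n)) (*-monoʳ-≤-nonNeg (fromℕ n) (<⇒≤ c<1)))
  r+m≡n : r ℕ.+ m ≡ n
  r+m≡n = ℕ.m∸n+n≡m m≤n
  z+j≡1+r : z ℕ.+ j ≡ suc r
  z+j≡1+r = ℕ.m∸n+n≡m (ℕ.m≤n⇒m≤1+n j≤r)
  r≡[1-c]n : fromℕ r ≡ (1ℚ - c) * fromℕ n
  r≡[1-c]n = begin
    fromℕ r                        ≡⟨ solve 2 (λ r m → r := r :+ m :- m) refl (fromℕ r) (fromℕ m) ⟩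
    fromℕ r + fromℕ m - fromℕ m    ≡⟨ cong₂ _-_ (trans (sym (fromℕ-+ r m)) (cong fromℕ r+m≡n)) m≡cn ⟩
    fromℕ n - c * fromℕ n          ≡⟨ solve 2 (λ n c → n :- c :* n := (con 1ℚ :- c) :* n) refl (fromℕ n) c ⟩
    (1ℚ - c) * fromℕ n             ∎
    where open ≡-Reasoning
  n≤qr : n ℕ.≤ q ℕ.* r
  n≤qr = fromℕ-cancel-≤ (subst₂ _≤_ (*-identityˡ (fromℕ n))
    (trans (*-assoc (fromℕ q) (1ℚ - c) (fromℕ n)) (trans (cong (fromℕ q *_) (sym r≡[1-c]n)) (sym (fromℕ-* q r))))
    (*-monoʳ-≤-nonNeg (fromℕ n) 1≤q[1-c]))
  open Bounds m n r z j q r+m≡n z+j≡1+r n≤qr using (κ; upper; lower)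
  upper′ : n ℕ.* num m n r z ℕ.≤ n ℕ.* den m n r z ℕ.+ K ℕ.* den m n r z
  upper′ = ℕ.≤-trans upper (ℕ.+-monoʳ-≤ (n ℕ.* den m n r z) (ℕ.*-monoˡ-≤ (den m n r z) (ℕ.m≤m+n 3 (q ℕ.* κ))))
  lower′ : n ℕ.* den m n r z ℕ.≤ n ℕ.* num m n r z ℕ.+ K ℕ.* den m n r z
  lower′ = ℕ.≤-trans lower (ℕ.+-monoʳ-≤ (n ℕ.* num m n r z) (ℕ.*-monoˡ-≤ (den m n r z) (ℕ.m≤n+m (q ℕ.* κ) 3)))

-- Keeping `J` apart from `j` yields the variance, where `j` is `i`, along the same pairs `(m, n)`
-- as the covariance.
Cov-asymptotic : ∀ i j J (1≤i : 1 ℕ.≤ i) → i ℕ.≤ j → j ℕ.≤ J → ∀ c (0<c : 0ℚ < c) (c<1 : c < 1ℚ) →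
  Asymptotic c J (λ m n → Cov (kℚ m n i) (kℚ m n j)) (ic/[1-c]³ i c c<1) {{ic/[1-c]³-nonZero 1≤i 0<c c<1}}
Cov-asymptotic i j J 1≤i i≤j j≤J c 0<c c<1 ε 0<ε =
  let (q , 1≤q[1-c]) = archimedean (1ℚ - c) (0<1-c c<1) ; (d , 1≤dε) = archimedean ε 0<ε in
  -- The successor gives the strict bound for `archimedean-bound` and also `1 ≤ n`.
  suc (errorConstant q j ℕ.* d) , λ m n Kd<n m≡cn J≤n∸m →
    Cov-near-limit m n i j q c (ic/[1-c]³ i c c<1) ε {{ic/[1-c]³-nonZero 1≤i 0<c c<1}}
      1≤i i≤j (ℕ.≤-trans j≤J J≤n∸m) (ℕ.≤-trans (ℕ.s≤s ℕ.z≤n) Kd<n) 0<c c<1 1≤q[1-c]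
      (÷-* (fromℕ i * c) (cube (1ℚ - c)) {{cube-nonZero c<1}}) m≡cn
      (archimedean-bound (errorConstant q j) d n 0<ε 1≤dε Kd<n)

proposition3p9 : (i j : ℕ) (1≤i : 1 ℕ.≤ i) (i<j : i ℕ.< j) →
    (c : ℚ) (0<c : 0ℚ < c) (c<1 : c < 1ℚ) →
    Asymptotic c j (λ m n → Var (kℚ m n i)) (ic/[1-c]³ i c c<1) {{ic/[1-c]³-nonZero 1≤i 0<c c<1}}
    × Asymptotic c j (λ m n → Cov (kℚ m n i) (kℚ m n j)) (ic/[1-c]³ i c c<1) {{ic/[1-c]³-nonZero 1≤i 0<c c<1}}
proposition3p9 i j 1≤i i<j c 0<c c<1 =
    Cov-asymptotic i i j 1≤i ℕ.≤-refl (ℕ.<⇒≤ i<j) c 0<c c<1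
  , Cov-asymptotic i j j 1≤i (ℕ.<⇒≤ i<j) ℕ.≤-refl c 0<c c<1
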